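{- There exists a constant $c > 0$ such that there are infinitely many $4$-regular $4$-connected graphs, each containing exactly $c$ Hamiltonian cycles.
   Context: Graphs are finite. A graph is $4$-regular if every vertex has degree $4$, and $4$-connected if it has more than $4$ vertices and remains connected after deleting any set of at most $3$ vertices. A Hamiltonian cycle is a cycle passing through every vertex of the graph exactly once. -}

module Defs where

open import Data.Nat using (ℕ; zero; suc; _<_; _≤_)
open import Data.Nat.DivMod using (_mod_)
open import Data.Fin using (Fin; toℕ)
open import Data.Fin.Subset using (Subset; _∉_; ∣_∣)
open import Data.Bool using (Bool; true; false)
open import Data.Vec using (tabulate)
open import Data.Product using (Σ; ∃; _×_; _,_)
open import Data.Sum using (_⊎_)
open import Function.Definitions using (Injective)
open import Function.Bundles using (_⇔_)
open import Relation.Binary.PropositionalEquality using (_≡_)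

record Graph (n : ℕ) : Set where
  field
    adj   : Fin n → Fin n → Bool
    sym   : ∀ u v → adj u v ≡ adj v u
    irrefl : ∀ v → adj v v ≡ false
open Graph public

nbhd : ∀ {n} → Graph n → Fin n → Subset n
nbhd G v = tabulate (adj G v)

degree : ∀ {n} → Graph n → Fin n → ℕ
degree G v = ∣ nbhd G v ∣

FourRegular : ∀ {n} → Graph n → Set
FourRegular G = ∀ v → degree G v ≡ 4

data WalkAvoiding {n} (G : Graph n) (S : Subset n) : Fin n → Fin n → Set where
  here : ∀ {v} → v ∉ S → WalkAvoiding G S v v
  step : ∀ {v w u} → v ∉ S → adj G v w ≡ true → WalkAvoiding G S w u → WalkAvoiding G S v u

ConnectedAvoiding : ∀ {n} → Graph n → Subset n → Set
ConnectedAvoiding G S = ∀ u v → u ∉ S → v ∉ S → WalkAvoiding G S u v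

FourConnected : ∀ {n} → Graph n → Set
FourConnected {n} G = (4 < n) × (∀ (S : Subset n) → ∣ S ∣ ≤ 3 → ConnectedAvoiding G S)

next : ∀ {n} → Fin n → Fin n
next {suc m} i = suc (toℕ i) mod suc m

-- A Hamiltonian cycle, given by a cyclic ordering σ of all vertices
-- (σ injective, hence a bijection of Fin n) with cyclically consecutive
-- vertices adjacent.
record HamCycle {n} (G : Graph n) : Set where
  field
    order    : Fin n → Fin n
    injective : Injective _≡_ _≡_ order
    adjacent : ∀ i → adj G (order i) (order (next i)) ≡ true
open HamCycle public

CycleEdge : ∀ {n} {G : Graph n} → HamCycle G → Fin n → Fin n → Set
CycleEdge C u v = ∃ λ i →
  (order C i ≡ u × order C (next i) ≡ v) ⊎ (order C i ≡ v × order C (next i) ≡ u)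

SameCycle : ∀ {n} {G : Graph n} → HamCycle G → HamCycle G → Set
SameCycle C D = ∀ u v → CycleEdge C u v ⇔ CycleEdge D u v

HasExactlyHamCycles : ∀ {n} → Graph n → ℕ → Set
HasExactlyHamCycles G c =
  Σ (Fin c → HamCycle G) λ H →
    (∀ i j → SameCycle (H i) (H j) → i ≡ j) × (∀ C → ∃ λ i → SameCycle C (H i))

{-# OPTIONS --safe #-}
-- A strip e 0, o 0, e 1, o 1, …, in which e t is moreover adjacent to o (t + 1)
-- and o (t + 2), is attached to a fixed finite core.  The core forces every
-- Hamiltonian cycle to enter the strip through the edge at e 0 and to avoid its
-- two edges to o 0 and its edge to o 1.  Hence both edges of the path at o 0 are
-- used, e 0 is saturated, its edges to o 1 and o 2 are unused, so both edges of
-- the path at o 1 are used, and so on: the strip is traversed along its path.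
-- The Hamiltonian cycles therefore correspond to the Hamiltonian paths of the
-- core with prescribed ends, whatever the length of the strip.
--
-- The core comes from a graph on 17 nodes, regular of degree 4 if six dangling
-- edges are counted, by replacing every node by K₄,₃.  A Hamiltonian cycle uses
-- exactly two of the four edges leaving each K₄,₃, so it induces on the 17 nodes
-- a subgraph with all degrees two and without closed cycles; a short case
-- analysis shows what such a subgraph does at the dangling edges.
--
-- For 4-connectivity, o t has three disjoint tracks back to the core, starting
-- with e t, e (t - 1) and e (t - 2), and a fourth path forward along the strip;
-- inside the core one follows edge-disjoint paths between the K₄,₃'s.

module Submission where

open import Defs hiding (sym)
open import Data.Nat as ℕ using (ℕ; zero; suc; _+_; _<_; _≤_; z≤n; s≤s; _*_; _∸_; _<?_; _≤?_; _^_)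
open import Data.Nat.Properties as ℕ using (≤-refl; <⇒≤; suc-injective; m≢1+n+m; m<n⇒m<1+n; n≤1+n; ≤-trans; ≤-antisym; ≤-reflexive; +-mono-≤; +-monoʳ-≤; +-suc; 1+n≰n; +-cancelˡ-≡; +-comm; <-irrefl; n<1+n; ≮⇒≥; ≤-pred; m+n∸n≡m; <⇒≱; <⇒≯; m≤n⇒m<n∨m≡n; +-identityʳ)
open import Data.Nat.DivMod using (_%_; _mod_; m%n<n; m<n⇒m%n≡m; n%n≡0)
open import Data.Fin as Fin using (Fin; zero; suc; toℕ; fromℕ; inject₁; opposite; _≟_; punchOut; #_; splitAt; _↑ˡ_; _↑ʳ_; combine; remQuot; join; finToFun; funToFin)
open import Data.Fin.Properties using (toℕ-injective; toℕ-fromℕ<; toℕ-fromℕ; toℕ-inject₁; toℕ<n; opposite-involutive; any?; punchOut-injective; injective⇒≤; all?; splitAt-↑ˡ; splitAt-↑ʳ; splitAt-join; join-splitAt; splitAt⁻¹-↑ˡ; splitAt⁻¹-↑ʳ; remQuot-combine; combine-remQuot; toℕ-↑ˡ; toℕ-↑ʳ; toℕ-combine; ↑ʳ-injective; funToFin-finToFin; finToFun-funToFin)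
open import Data.Fin.Relation.Unary.Top using (view; ‵fromℕ; ‵inject₁)
open import Data.Fin.Induction using (<-weakInduction; >-weakInduction)
open import Data.Bool using (Bool; true; false; if_then_else_; _∨_; _∧_; not)
import Data.Bool.Properties as Bool
open import Data.Empty using (⊥)
open import Data.Product using (Σ; ∃; _×_; _,_; proj₁; proj₂; ∃₂; map₂)
open import Data.Sum using (_⊎_; inj₁; inj₂; swap; [_,_]′)
open import Function using (_∘_; id)
open import Function.Definitions using (Injective)
open import Function.Bundles using (mk⇔; Equivalence)
open import Relation.Nullary using (¬_; Dec; yes; no; contradiction; does)
open import Relation.Nullary.Decidable using (_×-dec_; _⊎-dec_; dec-true; dec-false; does-⇔; ¬?; True; from-yes; _→-dec_; decidable-stable; map′)
open import Relation.Binary.PropositionalEquality using (_≡_; _≢_; refl; sym; trans; cong; cong₂; subst; subst₂; ≢-sym; _≗_)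
open import Data.Fin.Patterns using (0F; 1F; 2F; 3F; 4F; 5F)
open import Data.Fin.Subset using (Subset; inside; outside; _∈_; _∉_; _⊆_; ∣_∣; _-_; ⁅_⁆; _∪_)
open import Data.Fin.Subset.Properties using (x∈p⇒∣p-x∣<∣p∣; x∈p∧x≢y⇒x∈p-y; p⊆q⇒∣p∣≤∣q∣; x∈p∪q⁺; x∈⁅x⁆; ∣⁅x⁆∣≡1; ∣p∣≤∣x∷p∣; _∈?_)
open import Data.List using (List; []; _∷_; length)
open import Data.List.Relation.Unary.All as All using (All; []; _∷_)
open import Data.List.Relation.Unary.AllPairs using (AllPairs; []; _∷_)
open import Data.Vec using (tabulate; []; _∷_; Vec; lookup; updateAt; _[_]≔_; concat)
open import Data.Vec.Properties using (lookup∘tabulate; []=⇒lookup; lookup⇒[]=; lookup∘updateAt; lookup∘updateAt′; lookup∘update; lookup∘update′)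
import Data.Product.Properties as Product
import Data.Sum.Properties as Sum
open import Data.List.Relation.Unary.Any as Any using (Any; here; there)
open import Data.List.Relation.Unary.All.Properties using (¬Any⇒All¬)
open import Data.Maybe using (Maybe; just; nothing)
open import Data.Maybe.Properties as Maybe using (just-injective)
open import Data.Nat.Solver using (module +-*-Solver)
open import Data.Vec.Relation.Unary.AllPairs using (allPairs?)
open import Data.Vec.Relation.Unary.Unique.Propositional using (Unique)
open import Data.Vec.Relation.Unary.Unique.Propositional.Properties using (lookup-injective)

-- Cyclic successors

-- The constant `c` is never computed. The Hamiltonian paths of the core form a decidable set of
-- functions on 120 points whose description does not mention the length of the strip. Enumerating
-- it formally gives one number for all the graphs, and a single explicit path makes that number
-- positive. The K₄,₃'s also carry the connectivity proof. Every port becomes a vertex of its own,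
-- and a surviving vertex of the part of size three joins all ports of its node, so edge-disjoint
-- paths between nodes withstand the deletion of vertices. Moreover the double edges of the 17-node
-- graph become simple edges. Double edges are what complicates the case analysis. They are merged
-- beforehand: a cycle using both edges of a pair would be trapped in two copies of K₄,₃. The
-- analysis itself is a certificate, a decision tree whose leaves are checked by evaluation.

next-inject₁ : ∀ {m} (i : Fin m) → next (inject₁ i) ≡ suc i
next-inject₁ {m} i = toℕ-injective (trans (toℕ-fromℕ< (m%n<n (suc (toℕ (inject₁ i))) (suc m))) (trans
  (cong (λ k → suc k % suc m) (toℕ-inject₁ i)) (m<n⇒m%n≡m (s≤s (toℕ<n i)))))

next-fromℕ : ∀ m → next (fromℕ m) ≡ zero
next-fromℕ m = toℕ-injective (trans (toℕ-fromℕ< (m%n<n (suc (toℕ (fromℕ m))) (suc m))) (trans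
  (cong (λ k → suc k % suc m) (toℕ-fromℕ m)) (n%n≡0 (suc m))))

toℕ-next : ∀ {n} {i : Fin n} → suc (toℕ i) < n → toℕ (next i) ≡ suc (toℕ i)
toℕ-next {suc m} {i} lt = trans (toℕ-fromℕ< (m%n<n (suc (toℕ i)) (suc m))) (m<n⇒m%n≡m lt)

next-last : ∀ {m} {i : Fin (suc m)} → toℕ i ≡ m → next i ≡ zero
next-last {m} {i} eq = toℕ-injective (trans (toℕ-fromℕ< (m%n<n (suc (toℕ i)) (suc m))) (trans (cong (λ k → suc k % suc m) eq) (n%n≡0 (suc m))))

prev : ∀ {n} → Fin n → Fin n
prev {suc m} zero    = fromℕ m
prev {suc m} (suc i) = inject₁ i

next-prev : ∀ {n} (i : Fin n) → next (prev i) ≡ i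
next-prev {suc m} zero    = next-fromℕ m
next-prev {suc m} (suc i) = next-inject₁ i

prev-next : ∀ {n} (i : Fin n) → prev (next i) ≡ i
prev-next {suc m} i with view i
... | ‵fromℕ     = cong prev (next-fromℕ m)
... | ‵inject₁ j = cong prev (next-inject₁ j)

next-injective : ∀ {n} {i j : Fin n} → next i ≡ next j → i ≡ j
next-injective {i = i} {j} eq = trans (sym (prev-next i)) (trans (cong prev eq) (prev-next j))

opposite-inject₁ : ∀ {m} (i : Fin m) → opposite (inject₁ i) ≡ suc (opposite i)
opposite-inject₁ zero    = refl
opposite-inject₁ (suc i) = cong inject₁ (opposite-inject₁ i)

opposite-fromℕ : ∀ m → opposite (fromℕ m) ≡ zero
opposite-fromℕ zero    = refl
opposite-fromℕ (suc m) = cong inject₁ (opposite-fromℕ m)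

next-opposite-next : ∀ {n} (i : Fin n) → next (opposite (next i)) ≡ opposite i
next-opposite-next {suc m} i with view i
... | ‵fromℕ     = trans (cong (next ∘ opposite) (next-fromℕ m)) (trans (next-fromℕ m) (sym (opposite-fromℕ m)))
... | ‵inject₁ j = trans (cong (next ∘ opposite) (next-inject₁ j)) (trans (next-inject₁ (opposite j)) (sym (opposite-inject₁ j)))

next^ : ∀ {n} → ℕ → Fin n → Fin n
next^ zero    i = i
next^ (suc k) i = next (next^ k i)

next^-comm : ∀ {n} k (i : Fin n) → next^ k (next i) ≡ next (next^ k i)
next^-comm zero    i = refl
next^-comm (suc k) i = cong next (next^-comm k i)

next^-toℕ : ∀ {m} (i : Fin (suc m)) → next^ (toℕ i) zero ≡ i
next^-toℕ = <-weakInduction (λ i → next^ (toℕ i) zero ≡ i) refl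
  λ i eq → trans (cong next (trans (cong (λ k → next^ k zero) (sym (toℕ-inject₁ i))) eq)) (next-inject₁ i)

-- Fails for two vertices, hence `3 + m`. It makes the predecessor and the successor of a vertex on
-- a Hamiltonian cycle distinct.
next²≢ : ∀ {m} (i : Fin (3 + m)) → next (next i) ≢ i
next²≢ {m} i eq with view i
... | ‵fromℕ = contradiction (trans (sym (trans (cong next (next-fromℕ (2 + m))) (next-inject₁ zero))) eq) λ ()
... | ‵inject₁ j with view j
...   | ‵fromℕ = contradiction (trans (sym (trans (cong next (next-inject₁ (fromℕ (1 + m)))) (next-fromℕ (2 + m)))) eq) λ ()
...   | ‵inject₁ k = m≢1+n+m (toℕ k) {1} (trans (sym (trans (toℕ-inject₁ (inject₁ k)) (toℕ-inject₁ k)))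
        (cong toℕ (trans (sym eq) (trans (cong next (next-inject₁ (inject₁ k))) (next-inject₁ (suc k))))))

-- The property is pushed up from `i` to the last index, wraps around to zero and is pushed up from
-- there.
next-induction : ∀ {m} (Q : Fin (suc m) → Set) → (∀ i → Q i → Q (next i)) → ∀ i → Q i → ∀ j → Q j
next-induction {m} Q Q-next i Qi = <-weakInduction Q
  (subst Q (next-fromℕ m) (Q-next _ (>-weakInduction (λ i → Q i → Q (fromℕ m)) id
    (λ i f Qi → f (subst Q (next-inject₁ i) (Q-next _ Qi))) i Qi)))
  λ i Qi → subst Q (next-inject₁ i) (Q-next _ Qi)

-- Hamiltonian cycles

module _ {n} {G : Graph n} where

  edge? : (C : HamCycle G) → ∀ u v → Dec (CycleEdge C u v)
  edge? C u v = any? λ i → (order C i ≟ u ×-dec order C (next i) ≟ v) ⊎-dec (order C i ≟ v ×-dec order C (next i) ≟ u)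

  edge-sym : (C : HamCycle G) → ∀ {u v} → CycleEdge C u v → CycleEdge C v u
  edge-sym C (i , e) = i , swap e

  SameCycle-trans : {C D E : HamCycle G} → SameCycle C D → SameCycle D E → SameCycle C E
  SameCycle-trans s t u v = mk⇔ (Equivalence.to (t u v) ∘ Equivalence.to (s u v)) (Equivalence.from (s u v) ∘ Equivalence.from (t u v))

  SameCycle-≗ : {C D : HamCycle G} → (∀ i → order C i ≡ order D i) → SameCycle C D
  SameCycle-≗ eq u v = mk⇔
    (λ { (i , inj₁ (p , q)) → i , inj₁ (trans (sym (eq i)) p , trans (sym (eq _)) q) ; (i , inj₂ (p , q)) → i , inj₂ (trans (sym (eq i)) p , trans (sym (eq _)) q) })
    (λ { (i , inj₁ (p , q)) → i , inj₁ (trans (eq i) p , trans (eq _) q) ; (i , inj₂ (p , q)) → i , inj₂ (trans (eq i) p , trans (eq _) q) })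

  rotate : HamCycle G → HamCycle G
  rotate C .order       = order C ∘ next
  rotate C .injective   = next-injective ∘ injective C
  rotate C .adjacent    = adjacent C ∘ next

  rotate-same : (C : HamCycle G) → SameCycle C (rotate C)
  rotate-same C u v = mk⇔
    (λ (i , e) → prev i , subst (λ j → (order C j ≡ u × order C (next j) ≡ v) ⊎ (order C j ≡ v × order C (next j) ≡ u)) (sym (next-prev i)) e)
    (λ (i , e) → next i , e)

  rotations : ℕ → HamCycle G → HamCycle G
  rotations zero    C = C
  rotations (suc k) C = rotate (rotations k C)

  rotations-order : ∀ k C i → order (rotations k C) i ≡ order C (next^ k i)
  rotations-order zero    C i = refl
  rotations-order (suc k) C i = trans (rotations-order k C (next i)) (cong (order C) (next^-comm k i))

  rotations-same : ∀ k C → SameCycle C (rotations k C)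
  rotations-same zero    C = SameCycle-≗ {C} {C} (λ _ → refl)
  rotations-same (suc k) C = SameCycle-trans {C} {rotations k C} {rotations (suc k) C} (rotations-same k C) (rotate-same (rotations k C))

  reflect : HamCycle G → HamCycle G
  reflect C .order       = order C ∘ opposite
  reflect C .injective {x} {y} eq = trans (sym (opposite-involutive x)) (trans (cong opposite (injective C eq)) (opposite-involutive y))
  reflect C .adjacent i = trans (Graph.sym G _ _)
    (subst (λ j → adj G (order C (opposite (next i))) (order C j) ≡ true) (next-opposite-next i) (adjacent C (opposite (next i))))

  reflect-edge : (C : HamCycle G) → ∀ {i} → CycleEdge (reflect C) (order C (next i)) (order C i)
  reflect-edge C {i} = opposite (next i) , inj₁ (cong (order C) (opposite-involutive (next i)) ,
    cong (order C) (trans (cong opposite (next-opposite-next i)) (opposite-involutive i)))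

  reflect-same : (C : HamCycle G) → SameCycle C (reflect C)
  reflect-same C u v = mk⇔ to from
    where
    to : CycleEdge C u v → CycleEdge (reflect C) u v
    to (i , inj₁ (refl , refl)) = edge-sym (reflect C) (reflect-edge C)
    to (i , inj₂ (refl , refl)) = reflect-edge C
    from : CycleEdge (reflect C) u v → CycleEdge C u v
    from (i , inj₁ (p , q)) = opposite (next i) , inj₂ (q , trans (cong (order C) (next-opposite-next i)) p)
    from (i , inj₂ (p , q)) = opposite (next i) , inj₁ (q , trans (cong (order C) (next-opposite-next i)) p)

module _ {m} {G : Graph (suc m)} where

  -- A rotation brings the edge to the front. If `C` traverses it from `v` to `u`, the reflection of
  -- `C` is rotated instead, in which `u` has position `opposite (next i)`.
  startingFrom : (C : HamCycle G) → ∀ {u v} → CycleEdge C u v →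
                 Σ (HamCycle G) λ D → SameCycle C D × order D zero ≡ u × order D (next zero) ≡ v
  startingFrom C {u} {v} (i , inj₁ (p , q)) = rotations (toℕ i) C , rotations-same (toℕ i) C ,
    trans (rotations-order (toℕ i) C zero) (trans (cong (order C) (next^-toℕ i)) p) ,
    trans (rotations-order (toℕ i) C (next zero)) (trans (cong (order C) (trans (next^-comm (toℕ i) zero) (cong next (next^-toℕ i)))) q)
  startingFrom C {u} {v} (i , inj₂ (refl , refl)) = let j = opposite (next i) ; D = reflect C ; eq = next^-toℕ j in
    rotations (toℕ j) D , SameCycle-trans {C = C} {D} {rotations (toℕ j) D} (reflect-same C) (rotations-same (toℕ j) D) ,
    trans (rotations-order (toℕ j) D zero) (trans (cong (order D) eq) (cong (order C) (opposite-involutive (next i)))) ,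
    trans (rotations-order (toℕ j) D (next zero)) (trans (cong (order D) (trans (next^-comm (toℕ j) zero) (cong next eq)))
      (cong (order C) (trans (cong opposite (next-opposite-next i)) (opposite-involutive i))))

module _ {n} {G : Graph n} (C : HamCycle G) where

  next-along : ∀ {q w} → CycleEdge C (order C (next q)) w → w ≢ order C q → order C (next (next q)) ≡ w
  next-along (i , inj₁ (p , r)) w≢ = trans (cong (order C ∘ next) (sym (injective C p))) r
  next-along (i , inj₂ (p , r)) w≢ = contradiction (trans (sym p) (cong (order C) (next-injective (injective C r)))) w≢

module _ {m} {G : Graph (3 + m)} (C : HamCycle G) where

  order-next²≢ : ∀ i → order C (next (next i)) ≢ order C i
  order-next²≢ i = next²≢ i ∘ injective C

  -- Two consecutive vertices fix the direction; from then on the edge set determines the order,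
  -- since the next vertex is the cycle neighbour other than the previous vertex.
  follow : (w : ℕ → Fin (3 + m)) → ∀ L → order C zero ≡ w 0 → order C (next zero) ≡ w 1 →
           (∀ j → j < L → CycleEdge C (w (suc j)) (w (2 + j)) × w (2 + j) ≢ w j) →
           ∀ j → j ≤ suc L → order C (next^ j zero) ≡ w j
  follow w L e₀ e₁ along zero          _ = e₀
  follow w L e₀ e₁ along (suc zero)    _ = e₁
  follow w L e₀ e₁ along (suc (suc j)) (s≤s j<L) = let (e , w≢) = along j j<L ; IH₀ = follow w L e₀ e₁ along j (<⇒≤ (m<n⇒m<1+n j<L)) ; IH₁ = follow w L e₀ e₁ along (suc j) (m<n⇒m<1+n j<L) in
    next-along C (subst (λ z → CycleEdge C z (w (2 + j))) (sym IH₁) e) (λ eq → w≢ (trans eq IH₀))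

agreement : ∀ {m} {G : Graph (3 + m)} {C D : HamCycle G} → SameCycle C D →
            order C zero ≡ order D zero → order C (next zero) ≡ order D (next zero) → ∀ i → order C i ≡ order D i
agreement {m} {G} {C} {D} same e₀ e₁ i = sym (trans (cong (order D) (sym (next^-toℕ i)))
  (trans (follow D w (toℕ i) (sym e₀) (sym e₁) (λ j _ → Equivalence.to (same _ _) (next^ (suc j) zero , inj₁ (refl , refl)) , order-next²≢ C (next^ j zero)) (toℕ i) (n≤1+n _))
    (cong (order C) (next^-toℕ i))))
  where
  w : ℕ → Fin (3 + m)
  w j = order C (next^ j zero)

-- Counting in finite sets

∈-distinct-≤ : ∀ {n} {S : Subset n} (xs : List (Fin n)) → All (_∈ S) xs → AllPairs _≢_ xs → length xs ≤ ∣ S ∣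
∈-distinct-≤ []       _            _         = z≤n
∈-distinct-≤ (x ∷ xs) (x∈S ∷ xs∈S) (x≢ ∷ ps) = ≤-trans
  (s≤s (∈-distinct-≤ xs (All.zipWith (λ (y∈S , x≢y) → x∈p∧x≢y⇒x∈p-y y∈S (≢-sym x≢y)) (xs∈S , x≢)) ps))
  (x∈p⇒∣p-x∣<∣p∣ x∈S)

∣p∪q∣≤∣p∣+∣q∣ : ∀ {n} (p q : Subset n) → ∣ p ∪ q ∣ ≤ ∣ p ∣ + ∣ q ∣
∣p∪q∣≤∣p∣+∣q∣ []            []            = z≤n
∣p∪q∣≤∣p∣+∣q∣ (outside ∷ p) (outside ∷ q) = ∣p∪q∣≤∣p∣+∣q∣ p q
∣p∪q∣≤∣p∣+∣q∣ (outside ∷ p) (inside ∷ q)  = ≤-trans (s≤s (∣p∪q∣≤∣p∣+∣q∣ p q)) (≤-reflexive (sym (+-suc ∣ p ∣ ∣ q ∣)))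
∣p∪q∣≤∣p∣+∣q∣ (inside ∷ p)  (s ∷ q)       = s≤s (≤-trans (∣p∪q∣≤∣p∣+∣q∣ p q) (+-monoʳ-≤ ∣ p ∣ (∣p∣≤∣x∷p∣ s q)))

-- A missed value `y` could be punched out, which would inject `Fin (suc n)` into `Fin n`.
injective⇒surjective : ∀ {n} {f : Fin n → Fin n} → Injective _≡_ _≡_ f → ∀ y → ∃ λ x → f x ≡ y
injective⇒surjective {suc n} {f} inj y with any? (λ x → f x ≟ y)
... | yes p = p
... | no ¬p = contradiction (injective⇒≤ {f = λ x → punchOut {i = y} {j = f x} (λ eq → ¬p (x , sym eq))}
                  (λ {x} {z} eq → inj (punchOut-injective {i = y} (λ e → ¬p (x , sym e)) (λ e → ¬p (z , sym e)) eq))) 1+n≰n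

does-true : ∀ {P : Set} (p? : Dec P) → does p? ≡ true → P
does-true (yes p) _ = p

bit : Bool → ℕ
bit b = if b then 1 else 0

count₄ : (Fin 4 → Bool) → ℕ
count₄ f = bit (f 0F) + (bit (f 1F) + (bit (f 2F) + bit (f 3F)))

count₄-cong : ∀ {f g : Fin 4 → Bool} → (∀ k → f k ≡ g k) → count₄ f ≡ count₄ g
count₄-cong eq rewrite eq 0F | eq 1F | eq 2F | eq 3F = refl

count₄-pair : ∀ (f : Fin 4 → Bool) k l → k ≢ l → f k ≡ true → f l ≡ true → (∀ j → j ≢ k → j ≢ l → f j ≡ false) → count₄ f ≡ 2
count₄-pair f k l k≢l fk fl other = trans (count₄-cong eq) (pairs k l k≢l)
  where
  eq : ∀ j → f j ≡ does (j ≟ k) ∨ does (j ≟ l)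
  eq j with j ≟ k | j ≟ l
  ... | yes refl | _        = fk
  ... | no _     | yes refl = fl
  ... | no j≢k   | no j≢l   = other j j≢k j≢l
  pairs : ∀ k l → k ≢ l → count₄ (λ j → does (j ≟ k) ∨ does (j ≟ l)) ≡ 2
  pairs 0F 1F _ = refl
  pairs 0F 2F _ = refl
  pairs 0F 3F _ = refl
  pairs 1F 0F _ = refl
  pairs 1F 2F _ = refl
  pairs 1F 3F _ = refl
  pairs 2F 0F _ = refl
  pairs 2F 1F _ = refl
  pairs 2F 3F _ = refl
  pairs 3F 0F _ = refl
  pairs 3F 1F _ = refl
  pairs 3F 2F _ = refl
  pairs 0F 0F k≢k = contradiction refl k≢k
  pairs 1F 1F k≢k = contradiction refl k≢k
  pairs 2F 2F k≢k = contradiction refl k≢k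
  pairs 3F 3F k≢k = contradiction refl k≢k

-- Graphs with numbered neighbours

-- back v k is the number of v among the neighbours of its k-th neighbour.
record Ported (n : ℕ) : Set₁ where
  field
    V        : Set
    enc      : V → Fin n
    dec      : Fin n → V
    dec-enc  : ∀ v → dec (enc v) ≡ v
    enc-dec  : ∀ i → enc (dec i) ≡ i
    nb       : V → Fin 4 → V
    back     : V → Fin 4 → Fin 4
    nb-back  : ∀ v k → nb (nb v k) (back v k) ≡ v
    nb-inj   : ∀ v {k l} → nb v k ≡ nb v l → k ≡ l
    nb-irr   : ∀ v k → nb v k ≢ v

  enc-inj : ∀ {u v} → enc u ≡ enc v → u ≡ v
  enc-inj {u} {v} eq = trans (sym (dec-enc u)) (trans (cong dec eq) (dec-enc v))

  nb? : ∀ i j → Dec (∃ λ k → enc (nb (dec i) k) ≡ j)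
  nb? i j = any? λ k → enc (nb (dec i) k) ≟ j

  flip : ∀ i j → (∃ λ k → enc (nb (dec i) k) ≡ j) → ∃ λ k → enc (nb (dec j) k) ≡ i
  flip i j (k , refl) = back (dec i) k ,
    trans (cong (λ v → enc (nb v (back (dec i) k))) (dec-enc _)) (trans (cong enc (nb-back (dec i) k)) (enc-dec i))

  graph : Graph n
  graph .adj i j = does (nb? i j)
  graph .Graph.sym i j = does-⇔ (mk⇔ (flip i j) (flip j i)) (nb? i j) (nb? j i)
  graph .irrefl i = dec-false (nb? i i) λ (k , eq) → nb-irr (dec i) k (enc-inj (trans eq (sym (enc-dec i))))

  adj-nb : ∀ v k → adj graph (enc v) (enc (nb v k)) ≡ true
  adj-nb v k = dec-true (nb? (enc v) (enc (nb v k))) (k , cong (λ u → enc (nb u k)) (dec-enc v))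

  adj⇒nb : ∀ v {i} → adj graph (enc v) i ≡ true → ∃ λ k → enc (nb v k) ≡ i
  adj⇒nb v {i} eq with does-true (nb? (enc v) i) eq
  ... | k , p = k , trans (cong (λ u → enc (nb u k)) (sym (dec-enc v))) p

  regular : FourRegular graph
  regular i = ≤-antisym
    (≤-trans (p⊆q⇒∣p∣≤∣q∣ upper) (≤-trans (∣p∪q∣≤∣p∣+∣q∣ (⁅ x 0F ⁆ ∪ ⁅ x 1F ⁆) (⁅ x 2F ⁆ ∪ ⁅ x 3F ⁆)) (≤-trans
      (+-mono-≤ (∣p∪q∣≤∣p∣+∣q∣ ⁅ x 0F ⁆ ⁅ x 1F ⁆) (∣p∪q∣≤∣p∣+∣q∣ ⁅ x 2F ⁆ ⁅ x 3F ⁆))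
      (≤-reflexive (cong₂ _+_ (cong₂ _+_ (∣⁅x⁆∣≡1 (x 0F)) (∣⁅x⁆∣≡1 (x 1F))) (cong₂ _+_ (∣⁅x⁆∣≡1 (x 2F)) (∣⁅x⁆∣≡1 (x 3F))))))))
    (∈-distinct-≤ (x 0F ∷ x 1F ∷ x 2F ∷ x 3F ∷ []) (x∈ 0F ∷ x∈ 1F ∷ x∈ 2F ∷ x∈ 3F ∷ [])
      (((λ ()) ∘ x-inj ∷ (λ ()) ∘ x-inj ∷ (λ ()) ∘ x-inj ∷ []) ∷ ((λ ()) ∘ x-inj ∷ (λ ()) ∘ x-inj ∷ []) ∷ ((λ ()) ∘ x-inj ∷ []) ∷ [] ∷ []))
    where
    x : Fin 4 → Fin n
    x k = enc (nb (dec i) k)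
    x-inj : ∀ {k l} → x k ≡ x l → k ≡ l
    x-inj eq = nb-inj (dec i) (enc-inj eq)
    x∈ : ∀ k → x k ∈ nbhd graph i
    x∈ k = lookup⇒[]= (x k) _ (trans (lookup∘tabulate (adj graph i) (x k)) (dec-true (nb? i (x k)) (k , refl)))
    upper : nbhd graph i ⊆ (⁅ x 0F ⁆ ∪ ⁅ x 1F ⁆) ∪ (⁅ x 2F ⁆ ∪ ⁅ x 3F ⁆)
    upper {j} j∈ with does-true (nb? i j) (trans (sym (lookup∘tabulate (adj graph i) j)) ([]=⇒lookup j∈))
    ... | 0F , refl = x∈p∪q⁺ (inj₁ (x∈p∪q⁺ (inj₁ (x∈⁅x⁆ (x 0F)))))
    ... | 1F , refl = x∈p∪q⁺ (inj₁ (x∈p∪q⁺ {p = ⁅ x 0F ⁆} (inj₂ (x∈⁅x⁆ (x 1F)))))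
    ... | 2F , refl = x∈p∪q⁺ {p = ⁅ x 0F ⁆ ∪ ⁅ x 1F ⁆} (inj₂ (x∈p∪q⁺ (inj₁ (x∈⁅x⁆ (x 2F)))))
    ... | 3F , refl = x∈p∪q⁺ {p = ⁅ x 0F ⁆ ∪ ⁅ x 1F ⁆} (inj₂ (x∈p∪q⁺ {p = ⁅ x 2F ⁆} (inj₂ (x∈⁅x⁆ (x 3F)))))

module Used {m} (P : Ported (3 + m)) (C : HamCycle (Ported.graph P)) where
  open Ported P

  used : V → Fin 4 → Bool
  used v k = does (edge? C (enc v) (enc (nb v k)))

  used⇒edge : ∀ {v k} → used v k ≡ true → CycleEdge C (enc v) (enc (nb v k))
  used⇒edge {v} {k} = does-true (edge? C (enc v) (enc (nb v k)))

  used-back : ∀ v k → used v k ≡ used (nb v k) (back v k)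
  used-back v k = trans (does-⇔ (mk⇔ (edge-sym C) (edge-sym C)) (edge? C _ _) (edge? C _ _))
    (cong (λ w → does (edge? C (enc (nb v k)) (enc w))) (sym (nb-back v k)))

  -- The two used ports lead to the successor and to the predecessor of `v`, which differ because
  -- there are at least three vertices; injectivity of `order` and of `nb` rules out any other port.
  used-two : ∀ v → count₄ (used v) ≡ 2
  used-two v with injective⇒surjective (injective C) (enc v)
  ... | i , eq with adj⇒nb v (subst (λ z → adj graph z (order C (next i)) ≡ true) eq (adjacent C i))
                  | adj⇒nb v (subst₂ (λ z w → adj graph z w ≡ true) (trans (cong (order C) (next-prev i)) eq) refl
                      (trans (Graph.sym graph _ _) (adjacent C (prev i))))
  ... | k , ek | l , el = count₄-pair (used v) k l k≢l
        (dec-true (edge? C _ _) (i , inj₁ (eq , sym ek)))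
        (dec-true (edge? C _ _) (prev i , inj₂ (sym el , trans (cong (order C) (next-prev i)) eq)))
        λ j j≢k j≢l → dec-false (edge? C _ _) λ
          { (h , inj₁ (p , q)) → j≢k (nb-inj v (enc-inj (trans (sym q) (trans (cong (order C ∘ next) (injective C (trans p (sym eq)))) (sym ek)))))
          ; (h , inj₂ (p , q)) → j≢l (nb-inj v (enc-inj (trans (sym p) (trans (cong (order C)
              (trans (sym (prev-next h)) (cong prev (injective C (trans q (sym eq)))))) (sym el))))) }
    where
    k≢l : k ≢ l
    k≢l refl = order-next²≢ C (prev i) (trans (cong (order C ∘ next) (next-prev i)) (trans (sym ek) el))

  -- If no step of the cycle left `Q`, then `next-induction` would carry `Q` around the cycle from
  -- `u` to `w`.
  used-cut : (Q : V → Bool) → ∀ u w → Q u ≡ true → Q w ≡ false →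
             ∃₂ λ v k → Q v ≡ true × Q (nb v k) ≡ false × used v k ≡ true
  used-cut Q u w Qu Qw with any? (λ i → Q (dec (order C i)) Bool.≟ true ×-dec Q (dec (order C (next i))) Bool.≟ false)
  ... | yes (i , p , q) with adj⇒nb (dec (order C i)) (subst (λ z → adj graph z (order C (next i)) ≡ true) (sym (enc-dec (order C i))) (adjacent C i))
  ...   | k , ek = dec (order C i) , k , p , trans (cong Q (trans (sym (dec-enc _)) (cong dec ek))) q ,
            dec-true (edge? C _ _) (i , inj₁ (sym (enc-dec _) , sym ek))
  used-cut Q u w Qu Qw | no ¬p with injective⇒surjective (injective C) (enc u) | injective⇒surjective (injective C) (enc w)
  ... | i , ei | j , ej = contradiction (trans (sym Qw) (trans (cong Q (sym (dec-enc w))) (trans (cong (Q ∘ dec) (sym ej))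
          (next-induction (λ i → Q (dec (order C i)) ≡ true) keep i (trans (cong (Q ∘ dec) ei) (trans (cong Q (dec-enc u)) Qu)) j)))) λ ()
    where
    keep : ∀ i → Q (dec (order C i)) ≡ true → Q (dec (order C (next i))) ≡ true
    keep i Qi with Q (dec (order C (next i))) in eq
    ... | true  = refl
    ... | false = contradiction (i , Qi , eq) ¬p

-- Walks avoiding a set, and the colouring argument

module _ {n} {G : Graph n} {S : Subset n} where

  walk-trans : ∀ {i j k} → WalkAvoiding G S i j → WalkAvoiding G S j k → WalkAvoiding G S i k
  walk-trans (here _)     q = q
  walk-trans (step a e p) q = step a e (walk-trans p q)

  walk-alive : ∀ {i j} → WalkAvoiding G S i j → i ∉ S
  walk-alive (here a)     = a
  walk-alive (step a _ _) = a

  walk-sym : ∀ {i j} → WalkAvoiding G S i j → WalkAvoiding G S j i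
  walk-sym (here a)     = here a
  walk-sym (step a e p) = walk-trans (walk-sym p) (step (walk-alive p) (trans (Graph.sym G _ _) e) (here a))

module Walks {n} (P : Ported n) (S : Subset n) where
  open Ported P

  Alive Dead : V → Set
  Alive v = enc v ∉ S
  Dead v  = enc v ∈ S

  infix 4 _⇝_
  -- A record instead of a synonym, so that `u` and `v` can be inferred; they could not be recovered
  -- from `enc u` and `enc v`.
  record _⇝_ (u v : V) : Set where
    constructor ⟨_⟩
    field walk : WalkAvoiding graph S (enc u) (enc v)
  open _⇝_ public

  stay : ∀ {v} → Alive v → v ⇝ v
  stay a = ⟨ here a ⟩

  infixr 5 _▸_
  _▸_ : ∀ {u v w} → u ⇝ v → v ⇝ w → u ⇝ w
  ⟨ p ⟩ ▸ ⟨ q ⟩ = ⟨ walk-trans p q ⟩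

  ⇝-sym : ∀ {u v} → u ⇝ v → v ⇝ u
  ⇝-sym ⟨ p ⟩ = ⟨ walk-sym p ⟩

  ⇝-alive : ∀ {u v} → u ⇝ v → Alive u
  ⇝-alive ⟨ p ⟩ = walk-alive p

  hop : ∀ {u} k → Alive u → Alive (nb u k) → u ⇝ nb u k
  hop {u} k a b = ⟨ step a (adj-nb u k) (here b) ⟩

  DeadIn : (V → Fin 4) → Fin 4 → Set
  DeadIn colour c = ∃ λ v → Dead v × colour v ≡ c

  module _ (small : ∣ S ∣ ≤ 3) where

    some-colour-alive : (colour : V → Fin 4) → ¬ (∀ c → DeadIn colour c)
    some-colour-alive colour f = 1+n≰n (≤-trans
      (∈-distinct-≤ (x 0F ∷ x 1F ∷ x 2F ∷ x 3F ∷ []) (x∈ 0F ∷ x∈ 1F ∷ x∈ 2F ∷ x∈ 3F ∷ [])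
        (((λ ()) ∘ x-inj 0F 1F ∷ (λ ()) ∘ x-inj 0F 2F ∷ (λ ()) ∘ x-inj 0F 3F ∷ []) ∷ ((λ ()) ∘ x-inj 1F 2F ∷ (λ ()) ∘ x-inj 1F 3F ∷ []) ∷ ((λ ()) ∘ x-inj 2F 3F ∷ []) ∷ [] ∷ []))
      small)
      where
      x : Fin 4 → Fin n
      x c = enc (proj₁ (f c))
      x∈ : ∀ c → x c ∈ S
      x∈ c = proj₁ (proj₂ (f c))
      x-inj : ∀ c d → x c ≡ x d → c ≡ d
      x-inj c d eq = trans (sym (proj₂ (proj₂ (f c)))) (trans (cong colour (enc-inj eq)) (proj₂ (proj₂ (f d))))

    -- The form in which disjoint paths are used throughout: attempt `c` fails only because of a
    -- deleted vertex of colour `c`. Vertices of different colours are different, so three deletions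
    -- cannot spoil all four attempts.
    escape : (colour : V → Fin 4) {A : Fin 4 → Set} → (∀ c → A c ⊎ DeadIn colour c) → ∃ A
    escape colour f with f 0F | f 1F | f 2F | f 3F
    ... | inj₁ a | _ | _ | _ = 0F , a
    ... | inj₂ _ | inj₁ a | _ | _ = 1F , a
    ... | inj₂ _ | inj₂ _ | inj₁ a | _ = 2F , a
    ... | inj₂ _ | inj₂ _ | inj₂ _ | inj₁ a = 3F , a
    ... | inj₂ p | inj₂ q | inj₂ r | inj₂ s = contradiction (λ { 0F → p ; 1F → q ; 2F → r ; 3F → s }) (some-colour-alive colour)

-- The port graph

-- A node has four ports; a port is matched with a port of another node or with
-- one of six links, through which the core is attached to the strip.
Node Link : Set
Node = Fin 17
Link = Fin 6

pattern ℓa  = 0F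
pattern ℓq  = 1F
pattern ℓc₁ = 2F
pattern ℓc₂ = 3F
pattern ℓc₃ = 4F
pattern ℓr  = 5F

Target : Set
Target = Link ⊎ (Node × Fin 4)

pattern link c    = inj₁ c
pattern inner i k = inj₂ (i , k)

-- Found by computer search.  Opaque, because unfolding the table in open terms is
-- prohibitively slow.
opaque
  mates : Vec (Vec Target 4) 17
  mates =
    (node 9 0F ∷ node 11 0F ∷ node 16 0F ∷ node 16 1F ∷ []) ∷
    (node 6 0F ∷ node 7 0F ∷ node 12 0F ∷ link ℓc₁ ∷ []) ∷
    (node 8 0F ∷ node 14 0F ∷ node 16 2F ∷ link ℓc₃ ∷ []) ∷
    (node 6 1F ∷ node 14 1F ∷ node 14 2F ∷ link ℓc₂ ∷ []) ∷
    (node 5 0F ∷ node 7 1F ∷ node 7 2F ∷ link ℓq ∷ []) ∷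
    (node 4 0F ∷ node 6 2F ∷ node 6 3F ∷ link ℓa ∷ []) ∷
    (node 1 0F ∷ node 3 0F ∷ node 5 1F ∷ node 5 2F ∷ []) ∷
    (node 1 1F ∷ node 4 1F ∷ node 4 2F ∷ node 13 0F ∷ []) ∷
    (node 2 0F ∷ node 10 0F ∷ node 10 1F ∷ node 12 1F ∷ []) ∷
    (node 0 0F ∷ node 10 2F ∷ node 10 3F ∷ node 11 1F ∷ []) ∷
    (node 8 1F ∷ node 8 2F ∷ node 9 1F ∷ node 9 2F ∷ []) ∷
    (node 0 1F ∷ node 9 3F ∷ node 15 0F ∷ node 15 1F ∷ []) ∷
    (node 1 2F ∷ node 8 3F ∷ node 15 2F ∷ node 15 3F ∷ []) ∷
    (node 7 3F ∷ node 14 3F ∷ node 16 3F ∷ link ℓr ∷ []) ∷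
    (node 2 1F ∷ node 3 1F ∷ node 3 2F ∷ node 13 1F ∷ []) ∷
    (node 11 2F ∷ node 11 3F ∷ node 12 2F ∷ node 12 3F ∷ []) ∷
    (node 0 2F ∷ node 0 3F ∷ node 2 2F ∷ node 13 2F ∷ []) ∷ []
    where
    node : ∀ i {i<17 : True (i <? 17)} → Fin 4 → Target
    node i {i<17} k = inner (#_ i {m<n = i<17}) k

mate : Node → Fin 4 → Target
mate i k = lookup (lookup mates i) k

port : Link → Node × Fin 4
port ℓa  = # 5 , 3F
port ℓq  = # 4 , 3F
port ℓc₁ = # 1 , 3F
port ℓc₂ = # 3 , 3F
port ℓc₃ = # 2 , 3F
port ℓr  = # 13 , 3F

-- Checked for every port, this says that the table is symmetric and joins no node to itself; double
-- edges are allowed.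
Matched : Node → Fin 4 → Target → Set
Matched i k (link c)    = port c ≡ (i , k)
Matched i k (inner j l) = mate j l ≡ inner i k × j ≢ i

infix 4 _≟T_
_≟T_ : (s t : Target) → Dec (s ≡ t)
_≟T_ = Sum.≡-dec _≟_ (Product.≡-dec _≟_ _≟_)

matched? : ∀ i k t → Dec (Matched i k t)
matched? i k (link c)    = Product.≡-dec _≟_ _≟_ (port c) (i , k)
matched? i k (inner j l) = mate j l ≟T inner i k ×-dec ¬? (j ≟ i)

opaque
  unfolding mates

  mate-matched : ∀ i k → Matched i k (mate i k)
  mate-matched = from-yes (all? λ i → all? λ k → matched? i k (mate i k))

  mate-port : ∀ c → mate (proj₁ (port c)) (proj₂ (port c)) ≡ link c
  mate-port ℓa  = refl
  mate-port ℓq  = refl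
  mate-port ℓc₁ = refl
  mate-port ℓc₂ = refl
  mate-port ℓc₃ = refl
  mate-port ℓr  = refl

-- Every node i becomes a copy of K₄,₃ with parts A i and B i, and A i a carries
-- port a; y is the last vertex of the strip.
data D : Set where
  y : D
  A : Node → Fin 4 → D
  B : Node → Fin 3 → D


-- Numbering of the vertices

module _ {t : ℕ} where

  parity : Fin t × Fin 2 → Fin t ⊎ Fin t
  parity (i , zero)     = inj₁ i
  parity (i , suc zero) = inj₂ i

  strip : Fin (t * 2) → Fin t ⊎ Fin t
  strip j = parity (remQuot 2 j)

  unstrip : Fin t ⊎ Fin t → Fin (t * 2)
  unstrip (inj₁ i) = combine i (zero {1})
  unstrip (inj₂ i) = combine i (suc (zero {0}))

  strip-unstrip : ∀ s → strip (unstrip s) ≡ s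
  strip-unstrip (inj₁ i) = cong parity (remQuot-combine i (zero {1}))
  strip-unstrip (inj₂ i) = cong parity (remQuot-combine i (suc (zero {0})))

  unstrip-strip : ∀ j → unstrip (strip j) ≡ j
  unstrip-strip j = trans (unstrip-parity (remQuot 2 j)) (combine-remQuot {t} 2 j)
    where
    unstrip-parity : ∀ p → unstrip (parity p) ≡ combine (proj₁ p) (proj₂ p)
    unstrip-parity (i , zero)     = refl
    unstrip-parity (i , suc zero) = refl

module _ {N : ℕ} where

  cell : Fin (N * 7) → Fin N × (Fin 4 ⊎ Fin 3)
  cell j = map₂ (splitAt 4) (remQuot 7 j)

  uncell : Fin N × (Fin 4 ⊎ Fin 3) → Fin (N * 7)
  uncell (i , s) = combine i (join 4 3 s)

  cell-uncell : ∀ c → cell (uncell c) ≡ c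
  cell-uncell (i , s) = trans (cong (map₂ (splitAt 4)) (remQuot-combine i (join 4 3 s))) (cong (i ,_) (splitAt-join 4 3 s))

  uncell-cell : ∀ j → uncell (cell j) ≡ j
  uncell-cell j = trans (cong (combine (proj₁ (remQuot {N} 7 j))) (join-splitAt 4 3 (proj₂ (remQuot {N} 7 j)))) (combine-remQuot {N} 7 j)

coresize : ℕ
coresize = suc (17 * 7)

abstract
  encD : D → Fin coresize
  encD y       = zero
  encD (A i a) = suc (uncell {17} (i , inj₁ a))
  encD (B i b) = suc (uncell {17} (i , inj₂ b))

  -- The numbering of the core starts with `y`, so `y` directly follows the strip and a Hamiltonian
  -- path of the core starts at number zero.
  encD-y : encD y ≡ zero
  encD-y = refl

  decD : Fin coresize → D
  decD zero    = y
  decD (suc k) = vertex (cell {17} k)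
    module _ where
    vertex : Node × (Fin 4 ⊎ Fin 3) → D
    vertex (i , inj₁ a) = A i a
    vertex (i , inj₂ b) = B i b

  decD-encD : ∀ d → decD (encD d) ≡ d
  decD-encD y       = refl
  decD-encD (A i a) = cong (vertex (uncell {17} (i , inj₁ a))) (cell-uncell {17} (i , inj₁ a))
  decD-encD (B i b) = cong (vertex (uncell {17} (i , inj₂ b))) (cell-uncell {17} (i , inj₂ b))

  encD-decD : ∀ k → encD (decD k) ≡ k
  encD-decD zero    = refl
  encD-decD (suc k) = trans (enc-vertex (cell {17} k)) (cong suc (uncell-cell {17} k))
    where
    enc-vertex : ∀ c → encD (vertex k c) ≡ suc (uncell {17} c)
    enc-vertex (i , inj₁ a) = refl
    enc-vertex (i , inj₂ b) = refl

data Vertex (t : ℕ) : Set where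
  e o : Fin t → Vertex t
  δ   : D → Vertex t

module _ {t : ℕ} where

  enc : Vertex t → Fin (t * 2 + coresize)
  enc (e i) = unstrip (inj₁ i) ↑ˡ coresize
  enc (o i) = unstrip (inj₂ i) ↑ˡ coresize
  enc (δ d) = (t * 2) ↑ʳ encD d

  fromStrip : Fin t ⊎ Fin t → Vertex t
  fromStrip (inj₁ i) = e i
  fromStrip (inj₂ i) = o i

  dec : Fin (t * 2 + coresize) → Vertex t
  dec k = [ fromStrip ∘ strip {t} , δ ∘ decD ]′ (splitAt (t * 2) k)

  dec-enc : ∀ v → dec (enc v) ≡ v
  dec-enc (e i) rewrite splitAt-↑ˡ (t * 2) (unstrip (inj₁ i)) coresize = cong fromStrip (strip-unstrip {t} (inj₁ i))
  dec-enc (o i) rewrite splitAt-↑ˡ (t * 2) (unstrip (inj₂ i)) coresize = cong fromStrip (strip-unstrip {t} (inj₂ i))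
  dec-enc (δ d) rewrite splitAt-↑ʳ (t * 2) coresize (encD d) = cong δ (decD-encD d)

  enc-dec : ∀ k → enc (dec k) ≡ k
  enc-dec k with splitAt (t * 2) k in sp
  ... | inj₁ j = trans (enc-strip (strip {t} j)) (trans (cong (_↑ˡ coresize) (unstrip-strip {t} j)) (splitAt⁻¹-↑ˡ sp))
    where
    enc-strip : ∀ s → enc (fromStrip s) ≡ unstrip s ↑ˡ coresize
    enc-strip (inj₁ i) = refl
    enc-strip (inj₂ i) = refl
  ... | inj₂ j = trans (cong ((t * 2) ↑ʳ_) (encD-decD j)) (splitAt⁻¹-↑ʳ sp)

-- The graphs

module Family (T′ : ℕ) where

  -- At least two, so that `O 1`, where `ℓc₃` lands, and the two neighbours `E (1 + T′)` and `E T′`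
  -- of `y` exist.
  T : ℕ
  T = 2 + T′

  V : Set
  V = Vertex T

  -- Reduced modulo T; used for t < T only.
  at : ℕ → Fin T
  at t = t mod T

  toℕ-at : ∀ {t} → t < T → toℕ (at t) ≡ t
  toℕ-at {t} t<T = trans (toℕ-fromℕ< (m%n<n t T)) (m<n⇒m%n≡m t<T)

  at-toℕ : ∀ i → at (toℕ i) ≡ i
  at-toℕ i = toℕ-injective (toℕ-at (toℕ<n i))

  E O : ℕ → V
  E t = e (at t)
  O t = o (at t)

  π : Link → V
  π c = δ (A (proj₁ (port c)) (proj₂ (port c)))

  -- The neighbours of e t are o (t - 1), …, o (t + 2) and those of o t are
  -- e (t + 1), …, e (t - 2), with y and the core in place of missing vertices.
  ahead : ℕ → V
  ahead s = if does (s <? T) then O s else (if does (s ℕ.≟ T) then δ y else π ℓr)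

  nbE nbO : Fin 4 → ℕ → V
  nbE 0F zero = π ℓa
  nbE 0F (suc t) = O t
  nbE 1F t = O t
  nbE 2F t = ahead (1 + t)
  nbE 3F t = ahead (2 + t)
  nbO 0F t = if does (suc t <? T) then E (suc t) else δ y
  nbO 1F t = E t
  nbO 2F zero = π ℓc₁
  nbO 2F (suc t) = E t
  nbO 3F zero = π ℓc₂
  nbO 3F (suc zero) = π ℓc₃
  nbO 3F (suc (suc t)) = E t

  landing : Link → V
  landing ℓa  = E 0
  landing ℓq  = δ y
  landing ℓc₁ = O 0
  landing ℓc₂ = O 0
  landing ℓc₃ = O 1
  landing ℓr  = E (1 + T′)

  slot : Link → Fin 4
  slot ℓa  = 0F
  slot ℓq  = 0F
  slot ℓc₁ = 2F
  slot ℓc₂ = 3F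
  slot ℓc₃ = 3F
  slot ℓr  = 3F

  target : Target → V
  target (link c)    = landing c
  target (inner j l) = δ (A j l)

  nb : V → Fin 4 → V
  nb (e t) k          = nbE k (toℕ t)
  nb (o t) k          = nbO k (toℕ t)
  nb (δ y) 0F         = π ℓq
  nb (δ y) 1F         = O (1 + T′)
  nb (δ y) 2F         = E (1 + T′)
  nb (δ y) 3F         = E T′
  nb (δ (A i a)) 0F   = δ (B i 0F)
  nb (δ (A i a)) 1F   = δ (B i 1F)
  nb (δ (A i a)) 2F   = δ (B i 2F)
  nb (δ (A i a)) 3F   = target (mate i a)
  nb (δ (B i b)) k    = δ (A i k)

  backE backO : Fin 4 → ℕ → Fin 4
  backE 0F zero = 3F
  backE 0F (suc _) = 0F
  backE 1F _ = 1F
  backE 2F _ = 2F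
  backE 3F _ = 3F
  backO 0F t = if does (suc t <? T) then 0F else 1F
  backO 1F _ = 1F
  backO 2F zero = 3F
  backO 2F (suc _) = 2F
  backO 3F _ = 3F

  backT : Target → Fin 4
  backT (link c)    = slot c
  backT (inner _ _) = 3F

  back : V → Fin 4 → Fin 4
  back (e t) k = backE k (toℕ t)
  back (o t) k = backO k (toℕ t)
  back (δ y) 0F = 3F
  back (δ y) 1F = 0F
  back (δ y) 2F = 2F
  back (δ y) 3F = 3F
  back (δ (A i a)) 3F = backT (mate i a)
  back (δ (A i a)) _  = a
  back (δ (B i b)) k = inject₁ b

  nb-E : ∀ {t} → t < T → ∀ k → nb (E t) k ≡ nbE k t
  nb-E t<T k = cong (nbE k) (toℕ-at t<T)

  nb-O : ∀ {t} → t < T → ∀ k → nb (O t) k ≡ nbO k t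
  nb-O t<T k = cong (nbO k) (toℕ-at t<T)

  ahead-< : ∀ {s} → s < T → ahead s ≡ O s
  ahead-< {s} s<T rewrite dec-true (s <? T) s<T = refl

  ahead-T : ahead T ≡ δ y
  ahead-T rewrite dec-false (T <? T) (<-irrefl refl) | dec-true (T ℕ.≟ T) refl = refl

  ahead-suc-T : ahead (suc T) ≡ π ℓr
  ahead-suc-T rewrite dec-false (suc T <? T) (λ lt → <-irrefl refl (≤-trans (n<1+n _) (ℕ.<⇒≤ lt))) | dec-false (suc T ℕ.≟ T) (λ eq → <-irrefl (sym eq) (n<1+n T)) = refl

  nbO-0-< : ∀ {t} → suc t < T → nbO 0F t ≡ E (suc t)
  nbO-0-< {t} lt rewrite dec-true (suc t <? T) lt = refl

  nbO-0-last : nbO 0F (1 + T′) ≡ δ y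
  nbO-0-last rewrite dec-false (T <? T) (<-irrefl refl) = refl

  backO-0-< : ∀ {t} → suc t < T → backO 0F t ≡ 0F
  backO-0-< {t} lt rewrite dec-true (suc t <? T) lt = refl

  backO-0-last : backO 0F (1 + T′) ≡ 1F
  backO-0-last rewrite dec-false (T <? T) (<-irrefl refl) = refl

  last-index : ∀ {t} → t < T → ¬ (suc t < T) → t ≡ 1 + T′
  last-index t<T ¬lt = ≤-antisym (≤-pred t<T) (≤-pred (≮⇒≥ ¬lt))

  nb-landing : ∀ c → nb (landing c) (slot c) ≡ π c
  nb-landing ℓa  = nb-E (s≤s z≤n) 0F
  nb-landing ℓq  = refl
  nb-landing ℓc₁ = nb-O (s≤s z≤n) 2F
  nb-landing ℓc₂ = nb-O (s≤s z≤n) 3F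
  nb-landing ℓc₃ = nb-O (s≤s (s≤s z≤n)) 3F
  nb-landing ℓr  = trans (nb-E (n<1+n _) 3F) ahead-suc-T

  nb-π : ∀ c → nb (π c) 3F ≡ landing c
  nb-π c = cong target (mate-port c)

  private
    swap-nb : ∀ {u u′ v : V} {k l} → u ≡ u′ → k ≡ l → nb u′ l ≡ v → nb u k ≡ v
    swap-nb refl refl eq = eq

  back-E : ∀ t → t < T → ∀ k → nb (nbE k t) (backE k t) ≡ E t
  back-E zero    t<T 0F = nb-π ℓa
  back-E (suc t) t<T 0F = trans (nb-O (ℕ.<⇒≤ t<T) 0F) (nbO-0-< t<T)
  back-E t       t<T 1F = nb-O t<T 1F
  back-E t       t<T 2F with suc t <? T
  ... | yes lt = swap-nb {k = 2F} (ahead-< lt) refl (nb-O lt 2F)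
  ... | no ¬lt with refl ← last-index t<T ¬lt = swap-nb {k = 2F} ahead-T refl refl
  back-E t       t<T 3F with 2 + t <? T | suc t <? T
  ... | yes lt | _      = swap-nb {k = 3F} (ahead-< lt) refl (nb-O lt 3F)
  ... | no ¬lt | yes lt with refl ← suc-injective (last-index lt ¬lt) = swap-nb {k = 3F} ahead-T refl refl
  ... | no _   | no ¬lt with refl ← last-index t<T ¬lt = swap-nb {k = 3F} ahead-suc-T refl (nb-π ℓr)

  back-O : ∀ t → t < T → ∀ k → nb (nbO k t) (backO k t) ≡ O t
  back-O t t<T 0F with suc t <? T
  ... | yes lt = swap-nb {k = backO 0F t} (nbO-0-< lt) (backO-0-< lt) (nb-E lt 0F)
  ... | no ¬lt with refl ← last-index t<T ¬lt = swap-nb {k = backO 0F (1 + T′)} nbO-0-last backO-0-last refl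
  back-O t             t<T 1F = nb-E t<T 1F
  back-O zero          t<T 2F = nb-π ℓc₁
  back-O (suc t)       t<T 2F = trans (nb-E (ℕ.<⇒≤ t<T) 2F) (ahead-< t<T)
  back-O zero          t<T 3F = nb-π ℓc₂
  back-O (suc zero)    t<T 3F = nb-π ℓc₃
  back-O (suc (suc t)) t<T 3F = trans (nb-E (ℕ.<⇒≤ (ℕ.<⇒≤ t<T)) 3F) (ahead-< t<T)

  nb-back : ∀ v k → nb (nb v k) (back v k) ≡ v
  nb-back (e t) k = trans (back-E (toℕ t) (toℕ<n t) k) (cong e (at-toℕ t))
  nb-back (o t) k = trans (back-O (toℕ t) (toℕ<n t) k) (cong o (at-toℕ t))
  nb-back (δ y) 0F = nb-π ℓq
  nb-back (δ y) 1F = trans (nb-O (n<1+n _) 0F) nbO-0-last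
  nb-back (δ y) 2F = trans (nb-E (n<1+n _) 2F) ahead-T
  nb-back (δ y) 3F = trans (nb-E (m<n⇒m<1+n (n<1+n _)) 3F) ahead-T
  nb-back (δ (A i a)) 0F = refl
  nb-back (δ (A i a)) 1F = refl
  nb-back (δ (A i a)) 2F = refl
  nb-back (δ (A i a)) 3F with mate i a | mate-matched i a
  ... | link c    | eq      = trans (nb-landing c) (cong (λ (j , l) → δ (A j l)) eq)
  ... | inner j l | eq , _  = cong target eq
  nb-back (δ (B i 0F)) k = refl
  nb-back (δ (B i 1F)) k = refl
  nb-back (δ (B i 2F)) k = refl

  -- The neighbours of e t and of o t carry consecutive labels, hence differ.
  labelE labelO : V → ℕ
  labelE (e t)       = 0
  labelE (o t)       = suc (toℕ t)
  labelE (δ y)       = suc T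
  -- Among the core vertices, `π ℓa` stands for the missing `O` with index -1 and `π ℓr` for
  -- `O (suc T)`; `y` stands for `O T`.
  labelE (δ (A i a)) = if does (i ≟ proj₁ (port ℓa)) then 0 else 2 + T
  labelE (δ (B i b)) = 0
  labelO (e t)       = 2 + toℕ t
  labelO (o t)       = 0
  labelO (δ y)       = 2 + T
  -- Here `π ℓc₂` stands for the missing `E` with index -2, both `π ℓc₁` and `π ℓc₃` for the one
  -- with index -1, and `y` for `E T`.
  labelO (δ (A i a)) = if does (i ≟ proj₁ (port ℓc₂)) then 0 else 1
  labelO (δ (B i b)) = 0

  labelE-nbE : ∀ t → t < T → ∀ k → labelE (nbE k t) ≡ toℕ k + t
  labelE-nbE zero    t<T 0F = refl
  labelE-nbE (suc t) t<T 0F = cong suc (toℕ-at (ℕ.<⇒≤ t<T))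
  labelE-nbE t       t<T 1F = cong suc (toℕ-at t<T)
  labelE-nbE t       t<T 2F with suc t <? T
  ... | yes lt = trans (cong labelE (ahead-< lt)) (cong suc (toℕ-at lt))
  ... | no ¬lt with refl ← last-index t<T ¬lt = cong labelE ahead-T
  labelE-nbE t       t<T 3F with 2 + t <? T | suc t <? T
  ... | yes lt | _      = trans (cong labelE (ahead-< lt)) (cong suc (toℕ-at lt))
  ... | no ¬lt | yes lt with refl ← suc-injective (last-index lt ¬lt) = cong labelE ahead-T
  ... | no _   | no ¬lt with refl ← last-index t<T ¬lt = cong labelE ahead-suc-T

  labelO-nbO : ∀ t → t < T → ∀ k → toℕ k + labelO (nbO k t) ≡ 3 + t
  labelO-nbO t t<T 0F with suc t <? T
  ... | yes lt = trans (cong labelO (nbO-0-< lt)) (cong (2 +_) (toℕ-at lt))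
  ... | no ¬lt with refl ← last-index t<T ¬lt = cong labelO nbO-0-last
  labelO-nbO t             t<T 1F = cong (3 +_) (toℕ-at t<T)
  labelO-nbO zero          t<T 2F = refl
  labelO-nbO (suc t)       t<T 2F = cong (4 +_) (toℕ-at (ℕ.<⇒≤ t<T))
  labelO-nbO zero          t<T 3F = refl
  labelO-nbO (suc zero)    t<T 3F = refl
  labelO-nbO (suc (suc t)) t<T 3F = cong (5 +_) (toℕ-at (ℕ.<⇒≤ (ℕ.<⇒≤ t<T)))

  is-e is-o : V → Bool
  is-e (e _) = true
  is-e _     = false
  is-o (o _) = true
  is-o _     = false

  is-e-nbE : ∀ k t → is-e (nbE k t) ≡ false
  is-e-nbE 0F zero    = refl
  is-e-nbE 0F (suc t) = refl
  is-e-nbE 1F t       = refl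
  is-e-nbE 2F t       = is-e-ahead (1 + t)
    where
    is-e-ahead : ∀ s → is-e (ahead s) ≡ false
    is-e-ahead s with does (s <? T) | does (s ℕ.≟ T)
    ... | true  | _     = refl
    ... | false | true  = refl
    ... | false | false = refl
  is-e-nbE 3F t with does (2 + t <? T) | does (2 + t ℕ.≟ T)
  ... | true  | _     = refl
  ... | false | true  = refl
  ... | false | false = refl

  is-o-nbO : ∀ k t → is-o (nbO k t) ≡ false
  is-o-nbO 0F t with does (suc t <? T)
  ... | true  = refl
  ... | false = refl
  is-o-nbO 1F t             = refl
  is-o-nbO 2F zero          = refl
  is-o-nbO 2F (suc t)       = refl
  is-o-nbO 3F zero          = refl
  is-o-nbO 3F (suc zero)    = refl
  is-o-nbO 3F (suc (suc t)) = refl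

  target≢B : ∀ t {i b} → target t ≢ δ (B i b)
  target≢B (link ℓa)   ()
  target≢B (link ℓq)   ()
  target≢B (link ℓc₁)  ()
  target≢B (link ℓc₂)  ()
  target≢B (link ℓc₃)  ()
  target≢B (link ℓr)   ()
  target≢B (inner j l) ()

  landing≢A : ∀ c {i a} → landing c ≢ δ (A i a)
  landing≢A ℓa  ()
  landing≢A ℓq  ()
  landing≢A ℓc₁ ()
  landing≢A ℓc₂ ()
  landing≢A ℓc₃ ()
  landing≢A ℓr  ()

  nb-inj : ∀ v {k l} → nb v k ≡ nb v l → k ≡ l
  nb-inj (e t) {k} {l} eq = toℕ-injective (ℕ.+-cancelʳ-≡ (toℕ t) (toℕ k) (toℕ l)
    (trans (sym (labelE-nbE (toℕ t) (toℕ<n t) k)) (trans (cong labelE eq) (labelE-nbE (toℕ t) (toℕ<n t) l))))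
  nb-inj (o t) {k} {l} eq = toℕ-injective (ℕ.+-cancelʳ-≡ (labelO (nbO k (toℕ t))) (toℕ k) (toℕ l)
    (trans (labelO-nbO (toℕ t) (toℕ<n t) k) (trans (sym (labelO-nbO (toℕ t) (toℕ<n t) l)) (cong (λ v → toℕ l + labelO v) (sym eq)))))
  nb-inj (δ y) {0F} {0F} eq = refl
  nb-inj (δ y) {1F} {1F} eq = refl
  nb-inj (δ y) {2F} {2F} eq = refl
  nb-inj (δ y) {3F} {3F} eq = refl
  nb-inj (δ y) {0F} {1F} ()
  nb-inj (δ y) {0F} {2F} ()
  nb-inj (δ y) {0F} {3F} ()
  nb-inj (δ y) {1F} {2F} ()
  nb-inj (δ y) {1F} {3F} ()
  nb-inj (δ y) {2F} {3F} eq = contradiction (trans (sym (labelO-at (n<1+n _))) (trans (cong labelO eq) (labelO-at (m<n⇒m<1+n (n<1+n _))))) ℕ.1+n≢n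
    where
    labelO-at : ∀ {t} → t < T → labelO (E t) ≡ 2 + t
    labelO-at t<T = cong (2 +_) (toℕ-at t<T)
  nb-inj (δ y) {3F} {2F} eq = sym (nb-inj (δ y) {2F} {3F} (sym eq))
  nb-inj (δ (A i a)) {0F} {0F} eq = refl
  nb-inj (δ (A i a)) {1F} {1F} eq = refl
  nb-inj (δ (A i a)) {2F} {2F} eq = refl
  nb-inj (δ (A i a)) {3F} {3F} eq = refl
  nb-inj (δ (A i a)) {0F} {3F} eq = contradiction (sym eq) (target≢B (mate i a))
  nb-inj (δ (A i a)) {1F} {3F} eq = contradiction (sym eq) (target≢B (mate i a))
  nb-inj (δ (A i a)) {2F} {3F} eq = contradiction (sym eq) (target≢B (mate i a))
  nb-inj (δ (A i a)) {3F} {0F} eq = contradiction eq (target≢B (mate i a))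
  nb-inj (δ (A i a)) {3F} {1F} eq = contradiction eq (target≢B (mate i a))
  nb-inj (δ (A i a)) {3F} {2F} eq = contradiction eq (target≢B (mate i a))
  nb-inj (δ (B i b)) refl = refl

  nb-irr : ∀ v k → nb v k ≢ v
  nb-irr (e t) k eq = contradiction (trans (sym (is-e-nbE k (toℕ t))) (cong is-e eq)) λ ()
  nb-irr (o t) k eq = contradiction (trans (sym (is-o-nbO k (toℕ t))) (cong is-o eq)) λ ()
  nb-irr (δ y) 0F ()
  nb-irr (δ y) 1F ()
  nb-irr (δ y) 2F ()
  nb-irr (δ y) 3F ()
  nb-irr (δ (A i a)) 0F ()
  nb-irr (δ (A i a)) 1F ()
  nb-irr (δ (A i a)) 2F ()
  nb-irr (δ (B i b)) k ()
  nb-irr (δ (A i a)) 3F eq with mate i a | mate-matched i a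
  ... | link c    | _       = landing≢A c eq
  nb-irr (δ (A i a)) 3F refl | inner j l | _ , j≢i = j≢i refl

  ported : Ported (T * 2 + coresize)
  ported = record { V = V ; enc = enc ; dec = dec {T} ; dec-enc = dec-enc ; enc-dec = enc-dec {T} ; nb = nb ; back = back
                  ; nb-back = nb-back ; nb-inj = λ v → nb-inj v ; nb-irr = nb-irr }

-- Disjoint paths in the port graph

-- A path of the port graph is given by its initial node and the successive
-- ports through which it leaves a node.

Port : Set
Port = Node × Fin 4

end : Node → List (Fin 4) → Link ⊎ Node
end i []       = inj₂ i
end i (k ∷ ks) with mate i k
... | link c    = inj₁ c
... | inner j l = end j ks

ports : Node → List (Fin 4) → List Port
ports i []       = []
ports i (k ∷ ks) with mate i k
... | link c    = (i , k) ∷ []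
... | inner j l = (i , k) ∷ (j , l) ∷ ports j ks

Fan : Set
Fan = Vec (List (Fin 4)) 4

-- For every node, four edge-disjoint paths to links, and three to node 0 (the
-- fourth entry of a root fan is a dummy).
linkFans rootFans : Vec Fan 17
linkFans =
  ((2F ∷ 2F ∷ 3F ∷ []) ∷ (3F ∷ 3F ∷ 3F ∷ []) ∷ (0F ∷ 1F ∷ 0F ∷ 0F ∷ 1F ∷ 1F ∷ 3F ∷ []) ∷ (1F ∷ 2F ∷ 2F ∷ 0F ∷ 3F ∷ []) ∷ []) ∷
  ((3F ∷ []) ∷ (0F ∷ 1F ∷ 3F ∷ []) ∷ (1F ∷ 1F ∷ 3F ∷ []) ∷ (2F ∷ 1F ∷ 0F ∷ 3F ∷ []) ∷ []) ∷
  ((2F ∷ 3F ∷ 3F ∷ []) ∷ (3F ∷ []) ∷ (0F ∷ 3F ∷ 0F ∷ 3F ∷ []) ∷ (1F ∷ 1F ∷ 3F ∷ []) ∷ []) ∷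
  ((2F ∷ 3F ∷ 3F ∷ []) ∷ (3F ∷ []) ∷ (0F ∷ 0F ∷ 3F ∷ []) ∷ (1F ∷ 0F ∷ 3F ∷ []) ∷ []) ∷
  ((2F ∷ 3F ∷ 3F ∷ []) ∷ (1F ∷ 0F ∷ 3F ∷ []) ∷ (3F ∷ []) ∷ (0F ∷ 3F ∷ []) ∷ []) ∷
  ((2F ∷ 0F ∷ 3F ∷ []) ∷ (3F ∷ []) ∷ (0F ∷ 3F ∷ []) ∷ (1F ∷ 1F ∷ 3F ∷ []) ∷ []) ∷
  ((3F ∷ 3F ∷ []) ∷ (0F ∷ 3F ∷ []) ∷ (1F ∷ 3F ∷ []) ∷ (2F ∷ 0F ∷ 3F ∷ []) ∷ []) ∷
  ((2F ∷ 3F ∷ []) ∷ (3F ∷ 3F ∷ []) ∷ (0F ∷ 3F ∷ []) ∷ (1F ∷ 0F ∷ 3F ∷ []) ∷ []) ∷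
  ((1F ∷ 2F ∷ 3F ∷ 0F ∷ 3F ∷ 2F ∷ 3F ∷ []) ∷ (2F ∷ 3F ∷ 0F ∷ 2F ∷ 3F ∷ 3F ∷ []) ∷ (3F ∷ 0F ∷ 3F ∷ []) ∷ (0F ∷ 1F ∷ 1F ∷ 3F ∷ []) ∷ []) ∷
  ((3F ∷ 0F ∷ 3F ∷ 2F ∷ 3F ∷ []) ∷ (0F ∷ 2F ∷ 3F ∷ 3F ∷ []) ∷ (1F ∷ 1F ∷ 3F ∷ 0F ∷ 3F ∷ []) ∷ (2F ∷ 0F ∷ 0F ∷ 1F ∷ 1F ∷ 3F ∷ []) ∷ []) ∷
  ((1F ∷ 3F ∷ 0F ∷ 3F ∷ []) ∷ (2F ∷ 3F ∷ 0F ∷ 3F ∷ 2F ∷ 3F ∷ []) ∷ (3F ∷ 0F ∷ 2F ∷ 3F ∷ 3F ∷ []) ∷ (0F ∷ 0F ∷ 1F ∷ 1F ∷ 3F ∷ []) ∷ []) ∷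
  ((3F ∷ 3F ∷ 0F ∷ 3F ∷ []) ∷ (0F ∷ 3F ∷ 2F ∷ 3F ∷ []) ∷ (1F ∷ 0F ∷ 2F ∷ 3F ∷ 3F ∷ []) ∷ (2F ∷ 2F ∷ 1F ∷ 0F ∷ 1F ∷ 1F ∷ 3F ∷ []) ∷ []) ∷
  ((2F ∷ 0F ∷ 0F ∷ 3F ∷ 2F ∷ 3F ∷ []) ∷ (3F ∷ 1F ∷ 1F ∷ 0F ∷ 2F ∷ 3F ∷ 3F ∷ []) ∷ (0F ∷ 3F ∷ []) ∷ (1F ∷ 0F ∷ 1F ∷ 1F ∷ 3F ∷ []) ∷ []) ∷
  ((2F ∷ 2F ∷ 3F ∷ []) ∷ (3F ∷ []) ∷ (0F ∷ 0F ∷ 3F ∷ []) ∷ (1F ∷ 1F ∷ 3F ∷ []) ∷ []) ∷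
  ((2F ∷ 3F ∷ []) ∷ (3F ∷ 3F ∷ []) ∷ (0F ∷ 3F ∷ []) ∷ (1F ∷ 0F ∷ 0F ∷ 3F ∷ []) ∷ []) ∷
  ((3F ∷ 0F ∷ 3F ∷ []) ∷ (0F ∷ 0F ∷ 3F ∷ 2F ∷ 3F ∷ []) ∷ (1F ∷ 1F ∷ 0F ∷ 2F ∷ 3F ∷ 3F ∷ []) ∷ (2F ∷ 1F ∷ 0F ∷ 1F ∷ 1F ∷ 3F ∷ []) ∷ []) ∷
  ((1F ∷ 0F ∷ 1F ∷ 0F ∷ 0F ∷ 3F ∷ []) ∷ (2F ∷ 1F ∷ 1F ∷ 3F ∷ []) ∷ (3F ∷ 3F ∷ []) ∷ (0F ∷ 1F ∷ 2F ∷ 2F ∷ 0F ∷ 3F ∷ []) ∷ []) ∷ []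
rootFans =
  (([]) ∷ ([]) ∷ ([]) ∷ [] ∷ []) ∷
  ((0F ∷ 1F ∷ 1F ∷ 0F ∷ 2F ∷ 1F ∷ []) ∷ (1F ∷ 3F ∷ 2F ∷ 0F ∷ []) ∷ (2F ∷ 2F ∷ 0F ∷ 0F ∷ []) ∷ [] ∷ []) ∷
  ((2F ∷ 1F ∷ []) ∷ (0F ∷ 1F ∷ 2F ∷ 0F ∷ []) ∷ (1F ∷ 3F ∷ 2F ∷ 0F ∷ []) ∷ [] ∷ []) ∷
  ((2F ∷ 3F ∷ 2F ∷ 1F ∷ []) ∷ (0F ∷ 0F ∷ 2F ∷ 2F ∷ 0F ∷ 0F ∷ []) ∷ (1F ∷ 0F ∷ 2F ∷ 0F ∷ []) ∷ [] ∷ []) ∷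
  ((1F ∷ 3F ∷ 2F ∷ 1F ∷ []) ∷ (2F ∷ 0F ∷ 2F ∷ 2F ∷ 0F ∷ 0F ∷ []) ∷ (0F ∷ 1F ∷ 1F ∷ 1F ∷ 0F ∷ 2F ∷ 0F ∷ []) ∷ [] ∷ []) ∷
  ((0F ∷ 1F ∷ 3F ∷ 2F ∷ 1F ∷ []) ∷ (2F ∷ 0F ∷ 2F ∷ 2F ∷ 0F ∷ 0F ∷ []) ∷ (1F ∷ 1F ∷ 1F ∷ 0F ∷ 2F ∷ 0F ∷ []) ∷ [] ∷ []) ∷
  ((0F ∷ 2F ∷ 2F ∷ 0F ∷ 0F ∷ []) ∷ (1F ∷ 1F ∷ 0F ∷ 2F ∷ 1F ∷ []) ∷ (2F ∷ 0F ∷ 1F ∷ 3F ∷ 2F ∷ 0F ∷ []) ∷ [] ∷ []) ∷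
  ((3F ∷ 2F ∷ 1F ∷ []) ∷ (0F ∷ 2F ∷ 2F ∷ 0F ∷ 0F ∷ []) ∷ (1F ∷ 0F ∷ 1F ∷ 1F ∷ 1F ∷ 0F ∷ 2F ∷ 0F ∷ []) ∷ [] ∷ []) ∷
  ((2F ∷ 2F ∷ 3F ∷ 0F ∷ []) ∷ (0F ∷ 2F ∷ 0F ∷ []) ∷ (1F ∷ 3F ∷ 0F ∷ []) ∷ [] ∷ []) ∷
  ((1F ∷ 0F ∷ 0F ∷ 2F ∷ 0F ∷ []) ∷ (3F ∷ 0F ∷ []) ∷ (0F ∷ []) ∷ [] ∷ []) ∷
  ((2F ∷ 3F ∷ 0F ∷ []) ∷ (3F ∷ 0F ∷ []) ∷ (0F ∷ 0F ∷ 2F ∷ 0F ∷ []) ∷ [] ∷ []) ∷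
  ((2F ∷ 2F ∷ 1F ∷ 0F ∷ 2F ∷ 0F ∷ []) ∷ (0F ∷ []) ∷ (1F ∷ 0F ∷ []) ∷ [] ∷ []) ∷
  ((2F ∷ 0F ∷ 0F ∷ []) ∷ (3F ∷ 1F ∷ 1F ∷ 0F ∷ []) ∷ (1F ∷ 0F ∷ 2F ∷ 0F ∷ []) ∷ [] ∷ []) ∷
  ((2F ∷ 1F ∷ []) ∷ (0F ∷ 0F ∷ 2F ∷ 2F ∷ 0F ∷ 0F ∷ []) ∷ (1F ∷ 0F ∷ 2F ∷ 0F ∷ []) ∷ [] ∷ []) ∷
  ((3F ∷ 2F ∷ 1F ∷ []) ∷ (0F ∷ 2F ∷ 0F ∷ []) ∷ (1F ∷ 0F ∷ 0F ∷ 2F ∷ 2F ∷ 0F ∷ 0F ∷ []) ∷ [] ∷ []) ∷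
  ((2F ∷ 1F ∷ 0F ∷ 2F ∷ 0F ∷ []) ∷ (0F ∷ 0F ∷ []) ∷ (1F ∷ 1F ∷ 0F ∷ []) ∷ [] ∷ []) ∷
  ((1F ∷ []) ∷ (2F ∷ 0F ∷ 1F ∷ 2F ∷ 0F ∷ []) ∷ (0F ∷ []) ∷ [] ∷ []) ∷ []

linkPath rootPath : Node → Fin 4 → List (Fin 4)
linkPath i = lookup (lookup linkFans i)
rootPath i = lookup (lookup rootFans i)

_∈ports?_ : (p : Port) (ps : List Port) → Dec (Any (p ≡_) ps)
p ∈ports? ps = Any.any? (Product.≡-dec _≟_ _≟_ p) ps

-- A port is coloured by the first of the paths that contains it. That every port of path `c` has
-- colour `c` then expresses the pairwise disjointness of the fan.
strand : (Fin 4 → List (Fin 4)) → Node → Port → Fin 4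
strand f i p = if does (p ∈ports? ports i (f 0F)) then 0F else
               if does (p ∈ports? ports i (f 1F)) then 1F else
               if does (p ∈ports? ports i (f 2F)) then 2F else 3F

avoids? : ∀ i j ks → Dec (All (λ p → proj₁ p ≢ i) (ports j ks))
avoids? i j ks = All.all? (λ p → ¬? (proj₁ p ≟ i)) (ports j ks)

is-link : Link ⊎ Node → Bool
is-link (inj₁ _) = true
is-link (inj₂ _) = false

-- With `refl` as argument only the Boolean is evaluated, not the proofs built by the decision
-- procedure.
decide₂ : ∀ {m n} (P : Fin m → Fin n → Set) (P? : ∀ i j → Dec (P i j)) → does (all? λ i → all? λ j → P? i j) ≡ true → ∀ i j → P i j
decide₂ P P? = does-true (all? λ i → all? λ j → P? i j)

opaque
  unfolding mates

  linkPath-end : ∀ i c → is-link (end i (linkPath i c)) ≡ true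
  linkPath-end = decide₂ _ (λ i c → is-link (end i (linkPath i c)) Bool.≟ true) refl

  linkPath-disjoint : ∀ i c → All (λ p → strand (linkPath i) i p ≡ c) (ports i (linkPath i c))
  linkPath-disjoint = decide₂ _ (λ i c → All.all? (λ p → strand (linkPath i) i p ≟ c) (ports i (linkPath i c))) refl

  rootPath-end : ∀ i c → c ≢ 3F → end i (rootPath i c) ≡ inj₂ 0F
  rootPath-end = decide₂ _ (λ i c → ¬? (c ≟ 3F) →-dec Sum.≡-dec _≟_ _≟_ (end i (rootPath i c)) (inj₂ 0F)) refl

  rootPath-disjoint : ∀ i c → All (λ p → strand (rootPath i) i p ≡ c) (ports i (rootPath i c))
  rootPath-disjoint = decide₂ _ (λ i c → All.all? (λ p → strand (rootPath i) i p ≟ c) (ports i (rootPath i c))) refl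

  -- Needed when node `i` has lost its part of size three and cannot be passed through.
  linkPath-avoiding : ∀ i j → j ≢ i → ∃ λ c → All (λ p → proj₁ p ≢ i) (ports j (linkPath j c))
  linkPath-avoiding = decide₂ _ (λ i j → ¬? (j ≟ i) →-dec any? λ c → avoids? i j (linkPath j c)) refl

-- Connectivity

-- The tracks used below visit e s and o (s - 1) only for s in one class modulo 3.
class : ℕ → Fin 4
class 0                   = 0F
class 1                   = 1F
class 2                   = 2F
class (suc (suc (suc s))) = class s

-- Three consecutive indices meet all classes modulo 3; the colour `3F` is left for the fourth
-- track.
class-cover : ∀ s c → c ≡ class s ⊎ c ≡ class (1 + s) ⊎ c ≡ class (2 + s) ⊎ c ≡ 3F
class-cover 0 0F = inj₁ refl
class-cover 0 1F = inj₂ (inj₁ refl)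
class-cover 0 2F = inj₂ (inj₂ (inj₁ refl))
class-cover 0 3F = inj₂ (inj₂ (inj₂ refl))
class-cover 1 0F = inj₂ (inj₂ (inj₁ refl))
class-cover 1 1F = inj₁ refl
class-cover 1 2F = inj₂ (inj₁ refl)
class-cover 1 3F = inj₂ (inj₂ (inj₂ refl))
class-cover 2 0F = inj₂ (inj₁ refl)
class-cover 2 1F = inj₂ (inj₂ (inj₁ refl))
class-cover 2 2F = inj₁ refl
class-cover 2 3F = inj₂ (inj₂ (inj₂ refl))
class-cover (suc (suc (suc s))) c = class-cover s c

module Connectivity (T′ : ℕ) (S : Subset (Family.T T′ ℕ.* 2 + coresize)) (small : ∣ S ∣ ≤ 3) where
  open Family T′
  open Walks ported S

  dead? : ∀ v → Dec (Dead v)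
  dead? v = enc v ∈? S

  via : ∀ {u v} k → nb u k ≡ v → Alive u → Alive v → u ⇝ v
  via k refl = hop k

  -- A surviving vertex of the part of size three is adjacent to the whole part of size four. A path
  -- of the port graph can therefore be followed as soon as its ports are alive, even where several
  -- paths share a node.
  module Hubs (hubs : ∀ i → ∃ λ b → Alive (δ (B i b))) where

    hub : Node → V
    hub i = δ (B i (proj₁ (hubs i)))

    hub-alive : ∀ i → Alive (hub i)
    hub-alive i = proj₂ (hubs i)

    A⇝hub : ∀ i k → Alive (δ (A i k)) → δ (A i k) ⇝ hub i
    A⇝hub i k a = ⇝-sym (hop {hub i} k (hub-alive i) a)

    B⇝hub : ∀ i b → Alive (δ (B i b)) → δ (B i b) ⇝ hub i
    B⇝hub i b alive = proj₂ (escape small colour {λ k → δ (B i b) ⇝ hub i} λ k → try k (dead? (δ (A i k))))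
      where
      colour : V → Fin 4
      colour (δ (A _ k)) = k
      colour _           = 0F
      try : ∀ k → Dec (Dead (δ (A i k))) → δ (B i b) ⇝ hub i ⊎ DeadIn colour k
      try k (yes d) = inj₂ (δ (A i k) , d , refl)
      try k (no a)  = inj₁ (hop {δ (B i b)} k alive a ▸ A⇝hub i k a)

    End : Node → Link ⊎ Node → Set
    End i (inj₁ c) = Alive (landing c) → hub i ⇝ landing c
    End i (inj₂ j) = hub i ⇝ hub j

    extend : ∀ {i j} z → hub i ⇝ hub j → End j z → End i z
    extend (inj₁ c) p f = λ a → p ▸ f a
    extend (inj₂ k) p q = p ▸ q

    along : ∀ i ks → All (λ p → Alive (δ (A (proj₁ p) (proj₂ p)))) (ports i ks) → End i (end i ks)
    along i []       _ = stay (hub-alive i)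
    along i (k ∷ ks) alive with mate i k in eq
    along i (k ∷ ks) (a ∷ [])       | link c    = λ b → hop {hub i} k (hub-alive i) a ▸ via 3F (cong target eq) a b
    along i (k ∷ ks) (a ∷ b ∷ rest) | inner j l = extend (end j ks)
      (hop {hub i} k (hub-alive i) a ▸ via 3F (cong target eq) a b ▸ A⇝hub j l b) (along j ks rest)

    along-or-dead : ∀ i ks (colour : V → Fin 4) {c} → All (λ p → colour (δ (A (proj₁ p) (proj₂ p))) ≡ c) (ports i ks) →
                    End i (end i ks) ⊎ DeadIn colour c
    along-or-dead i ks colour {c} coloured with Any.any? (λ p → dead? (δ (A (proj₁ p) (proj₂ p)))) (ports i ks)
    ... | no ¬dead = inj₁ (along i ks (¬Any⇒All¬ (ports i ks) ¬dead))
    ... | yes dead = inj₂ (find coloured dead)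
      where
      find : ∀ {ps} → All (λ p → colour (δ (A (proj₁ p) (proj₂ p))) ≡ c) ps → Any (λ p → Dead (δ (A (proj₁ p) (proj₂ p)))) ps → DeadIn colour c
      find (eq ∷ _)  (here d)   = _ , d , eq
      find (_ ∷ eqs) (there ds) = find eqs ds

    -- Used when the strip is intact: all three deletions may then hit the core, and four
    -- edge-disjoint paths to links are called for.
    hub⇝link : (∀ c → Alive (landing c)) → ∀ i → ∃ λ c → hub i ⇝ landing c
    hub⇝link landed i = proj₂ (escape small colour {λ _ → ∃ λ c → hub i ⇝ landing c} λ k → try k (along-or-dead i (linkPath i k) colour (linkPath-disjoint i k)))
      where
      colour : V → Fin 4
      colour (δ (A j l)) = strand (linkPath i) i (j , l)
      colour _           = 0F
      try : ∀ k → End i (end i (linkPath i k)) ⊎ DeadIn colour k → (∃ λ c → hub i ⇝ landing c) ⊎ DeadIn colour k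
      try k (inj₂ d) = inj₂ d
      try k (inj₁ f) with end i (linkPath i k) | linkPath-end i k
      ... | inj₁ c | refl = inj₁ (c , f (landed c))

    -- The deleted `v` lies on none of the paths and takes the fourth colour. At most two deletions
    -- remain for the ports, so three edge-disjoint paths to node 0 suffice.
    hub⇝root : ∀ {v} → Dead v → (∀ j l → v ≢ δ (A j l)) → ∀ i → hub i ⇝ hub 0F
    hub⇝root {v} dead v≢A i = proj₂ (escape small colour {λ _ → hub i ⇝ hub 0F} try)
      where
      colour : V → Fin 4
      colour (δ (A j l)) = strand (rootPath i) i (j , l)
      colour _           = 3F
      colour-v : ∀ w → (∀ j l → w ≢ δ (A j l)) → colour w ≡ 3F
      colour-v (e _)       _ = refl
      colour-v (o _)       _ = refl
      colour-v (δ y)       _ = refl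
      colour-v (δ (A j l)) w≢ = contradiction refl (w≢ j l)
      colour-v (δ (B _ _)) _ = refl
      try : ∀ k → hub i ⇝ hub 0F ⊎ DeadIn colour k
      try k with k ≟ 3F
      ... | yes refl = inj₂ (v , dead , colour-v v v≢A)
      ... | no k≢3 with along-or-dead i (rootPath i k) colour (rootPath-disjoint i k)
      ...   | inj₂ d = inj₂ d
      ...   | inj₁ f = inj₁ (subst (End i) (rootPath-end i k k≢3) f)

    Core : V → Set
    Core v = ∃ λ i → v ⇝ hub i

    core-via : ∀ {u v} → u ⇝ v → Core v → Core u
    core-via p (i , q) = i , p ▸ q

    core-π : ∀ c → Alive (π c) → Core (π c)
    core-π c a = proj₁ (port c) , A⇝hub _ _ a

    -- The core end of a link gets the colour of the track ending there: `0F` at `ℓa`, `1F` at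
    -- `ℓc₂`, `3F` at `ℓq`, and `2F` at both `ℓc₁` and `ℓc₃`. The latter two never compete, as `ℓc₁`
    -- serves only the tracks of `O 0`, none of which reaches `O 1` backwards.
    portColours : Vec (Fin 4) 17
    portColours = 0F ∷ 2F ∷ 2F ∷ 1F ∷ 3F ∷ 0F ∷ 0F ∷ 0F ∷ 0F ∷ 0F ∷ 0F ∷ 0F ∷ 0F ∷ 0F ∷ 0F ∷ 0F ∷ 0F ∷ []

    -- Three disjoint tracks lead from o t back to the core, one leads forward.
    module Tracks (t : ℕ) (t≤T : t ≤ T) where

      -- Behind the start the tracks are told apart by their class modulo 3; what lies beyond
      -- belongs to the forward track and has colour `3F`.
      colour : V → Fin 4
      colour (e s)       = if does (toℕ s ≤? t) then class (toℕ s) else 3F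
      colour (o s)       = if does (toℕ s <? t) then class (suc (toℕ s)) else 3F
      colour (δ (A i _)) = lookup portColours i
      colour (δ _)       = 3F

      colour-E : ∀ {s} → s < T → s ≤ t → colour (E s) ≡ class s
      colour-E {s} s<T s≤t rewrite toℕ-at s<T | dec-true (s ≤? t) s≤t = refl

      colour-O : ∀ {s} → s < T → s < t → colour (O s) ≡ class (suc s)
      colour-O {s} s<T s<t rewrite toℕ-at s<T | dec-true (s <? t) s<t = refl

      colour-E-ahead : ∀ {s} → s < T → t < s → colour (E s) ≡ 3F
      colour-E-ahead {s} s<T t<s rewrite toℕ-at s<T | dec-false (s ≤? t) (<⇒≱ t<s) = refl

      colour-O-ahead : ∀ {s} → s < T → t < s → colour (O s) ≡ 3F
      colour-O-ahead {s} s<T t<s rewrite toℕ-at s<T | dec-false (s <? t) (<⇒≯ t<s) = refl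

      go : ∀ {u v c} k → nb u k ≡ v → Alive u → colour v ≡ c → (Alive v → Core v ⊎ DeadIn colour c) → Core u ⊎ DeadIn colour c
      go {v = v} k eq a col f with dead? v
      ... | yes d = inj₂ (v , d , col)
      ... | no b with f b
      ...   | inj₁ core = inj₁ (core-via (via k eq a b) core)
      ...   | inj₂ d    = inj₂ d

      -- A backward track alternates between `E (s + 1)`, `O s` and `E (s - 2)`: from one `E` to the
      -- next the index drops by three, so the class is constant. It ends at `ℓa`, `ℓc₂` or `ℓc₃`
      -- according to whether it reaches `E 0`, `O 0` or `O 1`.
      toE : ∀ {u s} k → nb u k ≡ E s → s < T → s ≤ t → Alive u → Core u ⊎ DeadIn colour (class s)
      toO : ∀ {u s} k → nb u k ≡ O s → s < T → s < t → Alive u → Core u ⊎ DeadIn colour (class (suc s))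
      toE {s = zero}  k eq s<T s≤t a = go k eq a (colour-E s<T s≤t) λ b → go 0F (nb-E s<T 0F) b refl (inj₁ ∘ core-π ℓa)
      toE {s = suc s} k eq s<T s≤t a = go k eq a (colour-E s<T s≤t) λ b → toO 0F (nb-E s<T 0F) (<⇒≤ s<T) s≤t b
      toO {s = zero}        k eq s<T s<t a = go k eq a (colour-O s<T s<t) λ b → go 3F (nb-O s<T 3F) b refl (inj₁ ∘ core-π ℓc₂)
      toO {s = suc zero}    k eq s<T s<t a = go k eq a (colour-O s<T s<t) λ b → go 3F (nb-O s<T 3F) b refl (inj₁ ∘ core-π ℓc₃)
      toO {s = suc (suc s)} k eq s<T s<t a = go k eq a (colour-O s<T s<t) λ b → toE 3F (nb-O s<T 3F) (<⇒≤ (<⇒≤ s<T)) (<⇒≤ (<⇒≤ (<⇒≤ s<t))) b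

      forwardY : ∀ {u} k → nb u k ≡ δ y → Alive u → Core u ⊎ DeadIn colour 3F
      forwardY k eq a = go k eq a refl λ b → go 0F refl b refl (inj₁ ∘ core-π ℓq)

      -- The path `O s`, `E (s + 1)`, `O (s + 1)` and so on to `y`, and from there over `ℓq`; `n`
      -- counts the remaining indices.
      forward : ∀ n s → n + suc s ≡ T → t ≤ s → Alive (O s) → Core (O s) ⊎ DeadIn colour 3F
      forward zero    s eq t≤s a with refl ← suc-injective eq = forwardY 0F (trans (nb-O (n<1+n _) 0F) nbO-0-last) a
      forward (suc n) s eq t≤s a = go 0F (trans (nb-O (<⇒≤ s+1<T) 0F) (nbO-0-< s+1<T)) a (colour-E-ahead s+1<T (s≤s t≤s)) λ b →
          go 1F (nb-E s+1<T 1F) b (colour-O-ahead s+1<T (s≤s t≤s)) (forward n (suc s) (trans (ℕ.+-suc n (suc s)) eq) (≤-trans t≤s (n≤1+n s)))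
        where
        s+1<T : suc s < T
        s+1<T = subst (suc s <_) eq (s≤s (ℕ.m≤n+m (suc s) n))

    tracksO : ∀ t (t<T : t < T) → Alive (O t) → ∀ c → Core (O t) ⊎ DeadIn (Tracks.colour t (<⇒≤ t<T)) c
    tracksO zero t<T a c with class-cover 0 c
    ... | inj₁ refl               = Tracks.toE 0 (<⇒≤ t<T) 1F (nb-O t<T 1F) t<T ≤-refl a
    ... | inj₂ (inj₁ refl)        = Tracks.go 0 (<⇒≤ t<T) 3F (nb-O t<T 3F) a refl (inj₁ ∘ core-π ℓc₂)
    ... | inj₂ (inj₂ (inj₁ refl)) = Tracks.go 0 (<⇒≤ t<T) 2F (nb-O t<T 2F) a refl (inj₁ ∘ core-π ℓc₁)
    ... | inj₂ (inj₂ (inj₂ refl)) = Tracks.forward 0 (<⇒≤ t<T) (T ∸ 1) 0 (ℕ.m∸n+n≡m t<T) ≤-refl a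
    tracksO (suc zero) t<T a c with class-cover 0 c
    ... | inj₁ refl               = Tracks.toE 1 (<⇒≤ t<T) 2F (nb-O t<T 2F) (<⇒≤ t<T) z≤n a
    ... | inj₂ (inj₁ refl)        = Tracks.toE 1 (<⇒≤ t<T) 1F (nb-O t<T 1F) t<T ≤-refl a
    ... | inj₂ (inj₂ (inj₁ refl)) = Tracks.go 1 (<⇒≤ t<T) 3F (nb-O t<T 3F) a refl (inj₁ ∘ core-π ℓc₃)
    ... | inj₂ (inj₂ (inj₂ refl)) = Tracks.forward 1 (<⇒≤ t<T) (T ∸ 2) 1 (ℕ.m∸n+n≡m t<T) ≤-refl a
    tracksO (suc (suc s)) t<T a c with class-cover s c
    ... | inj₁ refl               = Tracks.toE (2 + s) (<⇒≤ t<T) 3F (nb-O t<T 3F) (<⇒≤ (<⇒≤ t<T)) (≤-trans (n≤1+n s) (n≤1+n (suc s))) a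
    ... | inj₂ (inj₁ refl)        = Tracks.toE (2 + s) (<⇒≤ t<T) 2F (nb-O t<T 2F) (<⇒≤ t<T) (n≤1+n (suc s)) a
    ... | inj₂ (inj₂ (inj₁ refl)) = Tracks.toE (2 + s) (<⇒≤ t<T) 1F (nb-O t<T 1F) t<T ≤-refl a
    ... | inj₂ (inj₂ (inj₂ refl)) = Tracks.forward (2 + s) (<⇒≤ t<T) (T ∸ (3 + s)) (2 + s) (ℕ.m∸n+n≡m t<T) ≤-refl a

    core-O : ∀ t → t < T → Alive (O t) → Core (O t)
    core-O t t<T a = proj₂ (escape small (Tracks.colour t (<⇒≤ t<T)) {λ _ → Core (O t)} (tracksO t t<T a))

    core-y : Alive (δ y) → Core (δ y)
    core-y a = proj₂ (escape small colour {λ _ → Core (δ y)} tracks)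
      where
      -- With `t = T` the entire strip lies behind `y`, which leaves `3F` for the direct edge over
      -- `ℓq`.
      open Tracks T ≤-refl
      tracks : ∀ c → Core (δ y) ⊎ DeadIn colour c
      tracks c with class-cover T′ c
      ... | inj₁ refl               = toE 3F refl (m<n⇒m<1+n (n<1+n _)) (≤-trans (n≤1+n T′) (n≤1+n (suc T′))) a
      ... | inj₂ (inj₁ refl)        = toE 2F refl (n<1+n _) (n≤1+n (suc T′)) a
      ... | inj₂ (inj₂ (inj₁ refl)) = toO 1F refl (n<1+n _) (n<1+n _) a
      ... | inj₂ (inj₂ (inj₂ refl)) = go 0F refl a refl (inj₁ ∘ core-π ℓq)

    core-ahead : ∀ s → s ≤ suc T → Alive (ahead s) → Core (ahead s)
    core-ahead s s≤ a with m≤n⇒m<n∨m≡n s≤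
    ... | inj₂ refl = subst Core (sym ahead-suc-T) (core-π ℓr (subst Alive ahead-suc-T a))
    ... | inj₁ (s≤s s≤T) with m≤n⇒m<n∨m≡n s≤T
    ...   | inj₂ refl = subst Core (sym ahead-T) (core-y (subst Alive ahead-T a))
    ...   | inj₁ s<T  = subst Core (sym (ahead-< s<T)) (core-O s s<T (subst Alive (ahead-< s<T) a))

    core-nbE : ∀ k t → t < T → Alive (nbE k t) → Core (nbE k t)
    core-nbE 0F zero    t<T = core-π ℓa
    core-nbE 0F (suc t) t<T = core-O t (<⇒≤ t<T)
    core-nbE 1F t       t<T = core-O t t<T
    core-nbE 2F t       t<T = core-ahead (1 + t) (≤-trans t<T (n≤1+n T))
    core-nbE 3F t       t<T = core-ahead (2 + t) (s≤s t<T)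

    -- One of the four neighbours survives, and each surviving neighbour is already known to reach
    -- the core. The colour of a neighbour is its number, read off from the consecutive labels.
    core-e : ∀ t → Alive (e t) → Core (e t)
    core-e t a = proj₂ (escape small colour {λ _ → Core (e t)} try)
      where
      four : ℕ → Fin 4
      four 0 = 0F
      four 1 = 1F
      four 2 = 2F
      four _ = 3F
      four-toℕ : ∀ k → four (toℕ k) ≡ k
      four-toℕ 0F = refl
      four-toℕ 1F = refl
      four-toℕ 2F = refl
      four-toℕ 3F = refl
      colour : V → Fin 4
      colour v = four (labelE v ∸ toℕ t)
      try : ∀ k → Core (e t) ⊎ DeadIn colour k
      try k with dead? (nb (e t) k)
      ... | yes d = inj₂ (nb (e t) k , d , trans (cong (λ l → four (l ∸ toℕ t)) (labelE-nbE (toℕ t) (toℕ<n t) k)) (trans (cong four (m+n∸n≡m (toℕ k) (toℕ t))) (four-toℕ k)))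
      ... | no b  = inj₁ (core-via (hop {e t} k a b) (core-nbE k (toℕ t) (toℕ<n t) b))

    core : ∀ v → Alive v → Core v
    core (e t)       a = core-e t a
    core (o t)       a = subst Core (cong o (at-toℕ t)) (core-O (toℕ t) (toℕ<n t) (subst Alive (cong o (sym (at-toℕ t))) a))
    core (δ y)       a = core-y a
    core (δ (A i k)) a = i , A⇝hub i k a
    core (δ (B i b)) a = i , B⇝hub i b a

  module Strip (aliveE : ∀ t → t < T → Alive (E t)) (aliveO : ∀ t → t < T → Alive (O t)) (alive-y : Alive (δ y)) where

    E⇝E₀ : ∀ t → t < T → E t ⇝ E 0
    E⇝E₀ zero    t<T = stay (aliveE 0 t<T)
    E⇝E₀ (suc t) t<T = via 0F (nb-E t<T 0F) (aliveE (suc t) t<T) (aliveO t (<⇒≤ t<T)) ▸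
                       via 1F (nb-O (<⇒≤ t<T) 1F) (aliveO t (<⇒≤ t<T)) (aliveE t (<⇒≤ t<T)) ▸ E⇝E₀ t (<⇒≤ t<T)

    O⇝E₀ : ∀ t → t < T → O t ⇝ E 0
    O⇝E₀ t t<T = via 1F (nb-O t<T 1F) (aliveO t t<T) (aliveE t t<T) ▸ E⇝E₀ t t<T

    y⇝E₀ : δ y ⇝ E 0
    y⇝E₀ = via 2F refl alive-y (aliveE (1 + T′) (n<1+n _)) ▸ E⇝E₀ (1 + T′) (n<1+n _)

    landing⇝E₀ : ∀ c → landing c ⇝ E 0
    landing⇝E₀ ℓa  = E⇝E₀ 0 (s≤s z≤n)
    landing⇝E₀ ℓq  = y⇝E₀
    landing⇝E₀ ℓc₁ = O⇝E₀ 0 (s≤s z≤n)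
    landing⇝E₀ ℓc₂ = O⇝E₀ 0 (s≤s z≤n)
    landing⇝E₀ ℓc₃ = O⇝E₀ 1 (s≤s (s≤s z≤n))
    landing⇝E₀ ℓr  = E⇝E₀ (1 + T′) (n<1+n _)

  Rooted : Set
  Rooted = ∃ λ r → ∀ v → Alive v → v ⇝ r

  -- Some K₄,₃ has lost its whole part of size three, so nothing else is lost.
  rooted-blocked : ∀ i → (∀ b → Dead (δ (B i b))) → Rooted
  rooted-blocked i blocked = E 0 , reach
    where
    colour : V → Fin 4
    colour (δ (B j b)) = if does (j ≟ i) then Fin.inject₁ b else 3F
    colour _           = 3F
    colour-B : ∀ b → colour (δ (B i b)) ≡ Fin.inject₁ b
    colour-B b rewrite dec-true (i ≟ i) refl = refl
    -- The three vertices of the lost part take the colours `0F`, `1F` and `2F`; any further deleted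
    -- vertex would supply the fourth.
    alive : ∀ v → colour v ≡ 3F → Alive v
    alive v c d = some-colour-alive small colour λ
      { 0F → δ (B i 0F) , blocked 0F , colour-B 0F
      ; 1F → δ (B i 1F) , blocked 1F , colour-B 1F
      ; 2F → δ (B i 2F) , blocked 2F , colour-B 2F
      ; 3F → v , d , c }
    open Strip (λ t _ → alive (E t) refl) (λ t _ → alive (O t) refl) (alive (δ y) refl)
    alive-B : ∀ j b → j ≢ i → Alive (δ (B j b))
    alive-B j b j≢i = alive (δ (B j b)) (cong (λ d → if d then Fin.inject₁ b else 3F) (dec-false (j ≟ i) j≢i))
    aliveA : ∀ j k → Alive (δ (A j k))
    aliveA j k = alive (δ (A j k)) refl
    step-out : ∀ j k → j ≢ i → ∀ b → δ (B j b) ⇝ target (mate j k)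
    step-out j k j≢i b = hop {δ (B j b)} k (alive-B j b j≢i) (aliveA j k) ▸ hop {δ (A j k)} 3F (aliveA j k) (alive-target (mate j k))
      where
      alive-target : ∀ t → Alive (target t)
      alive-target (link c)    = alive (landing c) (colour-landing c)
        where
        colour-landing : ∀ c → colour (landing c) ≡ 3F
        colour-landing ℓa  = refl
        colour-landing ℓq  = refl
        colour-landing ℓc₁ = refl
        colour-landing ℓc₂ = refl
        colour-landing ℓc₃ = refl
        colour-landing ℓr  = refl
      alive-target (inner j l) = aliveA j l
    out : ∀ j ks → j ≢ i → All (λ p → proj₁ p ≢ i) (ports j ks) → is-link (end j ks) ≡ true → ∀ b → δ (B j b) ⇝ E 0
    out j (k ∷ ks) j≢i avoid isl b with mate j k in eq
    out j (k ∷ ks) j≢i avoid isl b | link c = subst (λ t → δ (B j b) ⇝ target t) eq (step-out j k j≢i b) ▸ landing⇝E₀ c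
    out j (k ∷ ks) j≢i (_ ∷ j′≢i ∷ avoid) isl b | inner j′ l =
      subst (λ t → δ (B j b) ⇝ target t) eq (step-out j k j≢i b) ▸ ⇝-sym (hop {δ (B j′ 0F)} l (alive-B j′ 0F j′≢i) (aliveA j′ l)) ▸ out j′ ks j′≢i avoid isl 0F
    reachB : ∀ j b → j ≢ i → δ (B j b) ⇝ E 0
    reachB j b j≢i with linkPath-avoiding i j j≢i
    ... | c , avoid = out j (linkPath j c) j≢i avoid (linkPath-end j c) b
    reachA : ∀ j k → δ (A j k) ⇝ E 0
    reachA j k with j ≟ i
    ... | no j≢i = ⇝-sym (hop {δ (B j 0F)} k (alive-B j 0F j≢i) (aliveA j k)) ▸ reachB j 0F j≢i
    -- All inner neighbours of `A i k` are deleted, so it is left through its port, which leads to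
    -- the strip or to another node.
    ... | yes refl with mate j k in eq | mate-matched j k
    ...   | link c    | _          = via 3F (cong target eq) (aliveA j k) (⇝-alive (landing⇝E₀ c)) ▸ landing⇝E₀ c
    ...   | inner l m | _ , l≢i = via 3F (cong target eq) (aliveA j k) (aliveA l m) ▸
              ⇝-sym (hop {δ (B l 0F)} m (alive-B l 0F l≢i) (aliveA l m)) ▸ reachB l 0F l≢i
    reach : ∀ v → Alive v → v ⇝ E 0
    reach (e t)       _ = subst (λ u → e u ⇝ E 0) (at-toℕ t) (E⇝E₀ (toℕ t) (toℕ<n t))
    reach (o t)       _ = subst (λ u → o u ⇝ E 0) (at-toℕ t) (O⇝E₀ (toℕ t) (toℕ<n t))
    reach (δ y)       _ = y⇝E₀
    reach (δ (A j k)) _ = reachA j k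
    reach (δ (B j b)) a with j ≟ i
    ... | no j≢i   = reachB j b j≢i
    ... | yes refl = contradiction (blocked b) a

  -- A deletion in the strip or at `y` leaves at most two for the rest, and everything reaches the
  -- hub of node 0. Otherwise strip and `y` are intact and connected, and everything reaches them
  -- over some link.
  rooted-hubs : (∀ i → ∃ λ b → Alive (δ (B i b))) → Rooted
  rooted-hubs hubs = cases (any? λ t → dead? (e t)) (any? λ t → dead? (o t)) (dead? (δ y))
    where
    open Hubs hubs
    at-root : ∀ {w} → Dead w → (∀ j l → w ≢ δ (A j l)) → Rooted
    at-root d w≢A = hub 0F , λ v a → let i , p = core v a in p ▸ hub⇝root d w≢A i
    cases : Dec (∃ λ t → Dead (e t)) → Dec (∃ λ t → Dead (o t)) → Dec (Dead (δ y)) → Rooted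
    cases (yes (t , d)) _ _ = at-root {e t} d λ _ _ ()
    cases (no _) (yes (t , d)) _ = at-root {o t} d λ _ _ ()
    cases (no _) (no _) (yes d) = at-root {δ y} d λ _ _ ()
    cases (no ¬e) (no ¬o) (no ¬y) = E 0 , λ v a → let i , p = core v a ; c , q = hub⇝link (⇝-alive ∘ landing⇝E₀) i in p ▸ q ▸ landing⇝E₀ c
      where open Strip (λ t _ d → ¬e (at t , d)) (λ t _ d → ¬o (at t , d)) ¬y

  rooted : Rooted
  rooted with any? (λ i → all? λ b → dead? (δ (B i b)))
  ... | yes (i , blocked) = rooted-blocked i blocked
  ... | no ¬blocked = rooted-hubs λ i → hub? i (any? λ b → ¬? (dead? (δ (B i b))))
    where
    hub? : ∀ i → Dec (∃ λ b → Alive (δ (B i b))) → ∃ λ b → Alive (δ (B i b))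
    hub? i (yes p) = p
    hub? i (no ¬p) = contradiction (i , λ b → decidable-stable (dead? (δ (B i b))) λ a → ¬p (b , a)) ¬blocked

  connected : ConnectedAvoiding (Ported.graph ported) S
  connected u v u∉S v∉S with rooted
  ... | r , reach = subst₂ (WalkAvoiding (Ported.graph ported) S) (enc-dec {T} u) (enc-dec {T} v) (walk (to u u∉S ▸ ⇝-sym (to v v∉S)))
    where
    to : ∀ w → w ∉ S → dec w ⇝ r
    to w w∉S = reach (dec w) (subst (_∉ S) (sym (enc-dec {T} w)) w∉S)

four-connected : ∀ T′ → FourConnected (Ported.graph (Family.ported T′))
four-connected T′ = s≤s (s≤s (s≤s (s≤s (ℕ.≤-trans (s≤s z≤n) (ℕ.m≤n+m _ _))))) , λ S small → Connectivity.connected T′ S small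

-- Exhaustion over quadruples of Booleans

bit-mono : ∀ a b → (a ≡ true → b ≡ true) → bit a ≤ bit b
bit-mono false _     _ = z≤n
bit-mono true  true  _ = ≤-refl
bit-mono true  false f = contradiction (f refl) λ ()

count₄-mono : ∀ {f g : Fin 4 → Bool} → (∀ k → f k ≡ true → g k ≡ true) → count₄ f ≤ count₄ g
count₄-mono le = ℕ.+-mono-≤ (bit-mono _ _ (le 0F)) (ℕ.+-mono-≤ (bit-mono _ _ (le 1F)) (ℕ.+-mono-≤ (bit-mono _ _ (le 2F)) (bit-mono _ _ (le 3F))))

∀Bool : (Bool → Bool) → Bool
∀Bool P = P true ∧ P false

∀Bool-sound : ∀ P → ∀Bool P ≡ true → ∀ b → P b ≡ true
∀Bool-sound P eq true  with P true
... | true = refl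
∀Bool-sound P eq false with P true | P false
... | true | true = refl

quad : Bool → Bool → Bool → Bool → Fin 4 → Bool
quad a b c d 0F = a
quad a b c d 1F = b
quad a b c d 2F = c
quad a b c d 3F = d

∀quad : ((Fin 4 → Bool) → Bool) → Bool
∀quad P = ∀Bool λ a → ∀Bool λ b → ∀Bool λ c → ∀Bool λ d → P (quad a b c d)

∀quad-sound : ∀ P → ∀quad P ≡ true → ∀ a b c d → P (quad a b c d) ≡ true
∀quad-sound P eq a b c d = ∀Bool-sound (λ d → P (quad a b c d)) (∀Bool-sound (λ c → ∀Bool λ d → P (quad a b c d))
  (∀Bool-sound (λ b → ∀Bool λ c → ∀Bool λ d → P (quad a b c d)) (∀Bool-sound (λ a → ∀Bool λ b → ∀Bool λ c → ∀Bool λ d → P (quad a b c d)) eq a) b) c) d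

count₄-not : ∀ f → count₄ f ≡ 2 → count₄ (not ∘ f) ≡ 2
count₄-not f eq with does-true (count₄ f ℕ.≟ 2 →-dec count₄ (not ∘ f) ℕ.≟ 2)
                       (∀quad-sound (λ f → does (count₄ f ℕ.≟ 2 →-dec count₄ (not ∘ f) ℕ.≟ 2)) refl (f 0F) (f 1F) (f 2F) (f 3F))
... | p = p eq

-- Covers of the port graph

leaves : (Node → Bool) → Target → Bool
leaves X (link c)    = true
leaves X (inner j l) = not (X j)

towards : Target → Target → Bool
towards (inner i _) (inner j _) = does (i ≟ j)
towards _           _           = false

-- The involution that exchanges the two ports of a double edge and fixes the ports of simple edges
-- and of links.
partner : Node → Fin 4 → Fin 4
partner i k = choose (parallel 0F) (parallel 1F) (parallel 2F) (parallel 3F)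
  where
  parallel : Fin 4 → Bool
  parallel l = not (does (l ≟ k)) ∧ towards (mate i l) (mate i k)
  choose : Bool → Bool → Bool → Bool → Fin 4
  choose true _    _    _    = 0F
  choose _    true _    _    = 1F
  choose _    _    true _    = 2F
  choose _    _    _    true = 3F
  choose _    _    _    _    = k

duplicate : Node → Fin 4 → Bool
duplicate i k = does (partner i k Fin.<? k)

-- The trace of a Hamiltonian cycle on the port graph: as the cycle also visits
-- the strip, it leaves every nonempty set of nodes.
record Cover (z : Node → Fin 4 → Bool) : Set where
  field
    degree-two : ∀ i → count₄ (z i) ≡ 2
    matched    : ∀ {i k j l} → mate i k ≡ inner j l → z i k ≡ z j l
    crossing   : ∀ X i → X i ≡ true → ∃₂ λ j k → X j ≡ true × leaves X (mate j k) ≡ true × z j k ≡ true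

-- Of two parallel edges at most one is used; recording it always in the first
-- port halves the search below at every double edge.
Merged : (Node → Fin 4 → Bool) → Set
Merged z = ∀ i k → duplicate i k ≡ true → z i k ≡ false

-- Certificates against partial covers

Env : Set
Env = Vec (Vec (Maybe Bool) 4) 17

get : Env → Node → Fin 4 → Maybe Bool
get env i k = lookup (lookup env i) k

put : Node → Fin 4 → Bool → Env → Env
put i k b env = updateAt env i (_[ k ]≔ just b)

assign′ : Target → Bool → Env → Env
assign′ (link c)    b env = env
assign′ (inner j l) b env = put j l b env

assign : Node → Fin 4 → Bool → Env → Env
assign i k b env = assign′ (mate i k) b (put i k b env)

is : Bool → Maybe Bool → Bool
is b (just c) = does (b Bool.≟ c)
is b nothing  = false

-- A leaf names a node of the wrong degree or a set of nodes left by no edge.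
data Refutation : Set where
  split : Node → Fin 4 → Refutation → Refutation → Refutation
  node  : Node → Refutation
  cut   : List Node → Refutation

member : List Node → Node → Bool
member is i = does (Any.any? (i ≟_) is)

closed : Env → (Node → Bool) → Node → Fin 4 → Bool
closed env X i k = not (X i) ∨ (not (leaves X (mate i k)) ∨ is false (get env i k))

refutes : Refutation → Env → Bool
refutes (split i k r s) env = refutes r (assign i k true env) ∧ refutes s (assign i k false env)
refutes (node i)        env = does (3 ≤? count₄ (is true ∘ get env i)) ∨ does (3 ≤? count₄ (is false ∘ get env i))
refutes (cut [])        env = false
refutes (cut (i ∷ is))  env = does (all? λ j → all? λ k → closed env (member (i ∷ is)) j k Bool.≟ true)

initial : Env
initial = tabulate λ i → tabulate λ k → if duplicate i k then just false else nothing

get-initial : ∀ i k → get initial i k ≡ (if duplicate i k then just false else nothing)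
get-initial i k = trans (cong (λ row → lookup row k) (lookup∘tabulate (λ i → tabulate λ k → if duplicate i k then just false else nothing) i))
                        (lookup∘tabulate (λ k → if duplicate i k then just false else nothing) k)

∨-true : ∀ a {b} → a ∨ b ≡ true → a ≡ true ⊎ b ≡ true
∨-true true  _  = inj₁ refl
∨-true false eq = inj₂ eq

module Soundness {z : Node → Fin 4 → Bool} (cover : Cover z) where
  open Cover cover

  Consistent : Env → Set
  Consistent env = ∀ i k {b} → get env i k ≡ just b → z i k ≡ b

  put-consistent : ∀ env i k {b} → z i k ≡ b → Consistent env → Consistent (put i k b env)
  put-consistent env i k {b} zb con j l {c} eq with j ≟ i
  ... | no j≢i = con j l (trans (cong (λ row → lookup row l) (sym (lookup∘updateAt′ j i j≢i env))) eq)
  ... | yes refl with trans (cong (λ row → lookup row l) (sym (lookup∘updateAt i {f = _[ k ]≔ just b} env))) eq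
  ...   | eq′ with l ≟ k
  ...     | yes refl = trans zb (just-injective (trans (sym (lookup∘update k (lookup env i) (just b))) eq′))
  ...     | no l≢k   = con j l (trans (sym (lookup∘update′ l≢k (lookup env i) (just b))) eq′)

  assign-consistent : ∀ env i k {b} → z i k ≡ b → Consistent env → Consistent (assign i k b env)
  assign-consistent env i k {b} zb con with mate i k in eq
  ... | link c    = put-consistent env i k zb con
  ... | inner j l = put-consistent (put i k b env) j l (trans (sym (matched eq)) zb) (put-consistent env i k zb con)

  is-sound : ∀ env i k {b} → Consistent env → is b (get env i k) ≡ true → z i k ≡ b
  is-sound env i k {b} con eq with get env i k in geq
  ... | just c = trans (con i k geq) (sym (does-true (b Bool.≟ c) eq))

  node-sound : ∀ env i → Consistent env → refutes (node i) env ≢ true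
  node-sound env i con eq with ∨-true (does (3 ≤? count₄ (is true ∘ get env i))) eq
  ... | inj₁ le = contradiction (≤-trans (does-true (3 ≤? _) le) (≤-trans (count₄-mono λ k → is-sound env i k con) (ℕ.≤-reflexive (degree-two i)))) λ { (s≤s (s≤s ())) }
  ... | inj₂ le = contradiction (≤-trans (does-true (3 ≤? _) le) (≤-trans (count₄-mono λ k e → cong not (is-sound env i k con e)) (ℕ.≤-reflexive (count₄-not (z i) (degree-two i))))) λ { (s≤s (s≤s ())) }

  cut-sound : ∀ env is → Consistent env → refutes (cut is) env ≢ true
  cut-sound env (i ∷ is) con eq with crossing (member (i ∷ is)) i (dec-true (Any.any? (i ≟_) (i ∷ is)) (here refl))
  ... | j , k , Xj , lv , zjk with does-true (all? λ j → all? λ k → closed env (member (i ∷ is)) j k Bool.≟ true) eq j k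
  ...   | cl rewrite Xj | lv = contradiction (trans (sym (is-sound env j k con cl)) zjk) λ ()

  sound : ∀ r env → Consistent env → refutes r env ≢ true
  sound (split i k r s) env con eq with z i k in zb | refutes r (assign i k true env) in er | refutes s (assign i k false env) in es
  ... | true  | true | _    = sound r (assign i k true env) (assign-consistent env i k zb con) er
  ... | false | true | true = sound s (assign i k false env) (assign-consistent env i k zb con) es
  sound (node i) env con eq = node-sound env i con eq
  sound (cut is) env con eq = cut-sound env is con eq

  initial-consistent : Merged z → Consistent initial
  initial-consistent merged i k eq with duplicate i k in d | trans (sym (get-initial i k)) eq
  ... | true | refl = merged i k d

refutation-a refutation-c₁ refutation-c₂ refutation-c₃ : Refutation
refutation-a = split (# 4) 0F (split (# 5) 1F (split (# 8) 1F (split (# 9) 1F (split (# 11) 2F (split (# 12) 2F (split (# 9) 3F (split (# 0) 0F (node (# 9)) (split (# 0) 1F (node (# 11)) (node (# 0)))) (split (# 0) 0F (split (# 0) 1F (split (# 0) 2F (node (# 0)) (split (# 2) 2F (split (# 13) 2F (split (# 8) 3F (split (# 2) 0F (node (# 8)) (split (# 1) 2F (node (# 12)) (cut (# 0 ∷ # 8 ∷ # 9 ∷ # 10 ∷ # 11 ∷ # 12 ∷ # 15 ∷ [])))) (split (# 2) 0F (split (# 2) 1F (node (# 2)) (split (# 2) 3F (node (# 2)) (split (# 1) 2F (split (# 3) 1F (split (# 13) 1F (split (# 7) 3F (node (# 13)) (split (# 1) 1F (split (# 1) 0F (node (# 1)) (split (# 1) 3F (node (# 1)) (split (# 3) 0F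 (split (# 3) 3F (node (# 3)) (split (# 4) 1F (split (# 4) 3F (node (# 4)) (split (# 13) 3F (node (# 13)) (cut (# 0 ∷ # 1 ∷ # 2 ∷ # 3 ∷ # 4 ∷ # 5 ∷ # 6 ∷ # 7 ∷ # 8 ∷ # 9 ∷ # 10 ∷ # 11 ∷ # 12 ∷ # 13 ∷ # 14 ∷ # 15 ∷ # 16 ∷ [])))) (node (# 7)))) (node (# 6))))) (node (# 7)))) (node (# 14))) (node (# 14))) (node (# 12))))) (node (# 8)))) (node (# 16))) (node (# 16)))) (node (# 11))) (node (# 9)))) (node (# 15))) (node (# 15))) (node (# 10))) (node (# 10))) (node (# 5))) (node (# 5))
refutation-c₁ = split (# 8) 1F (split (# 9) 1F (split (# 11) 2F (split (# 12) 2F (split (# 9) 3F (split (# 0) 0F (node (# 9)) (split (# 0) 1F (node (# 11)) (node (# 0)))) (split (# 0) 0F (split (# 0) 1F (split (# 0) 2F (node (# 0)) (split (# 2) 2F (split (# 13) 2F (split (# 8) 3F (split (# 2) 0F (node (# 8)) (split (# 1) 2F (node (# 12)) (cut (# 0 ∷ # 8 ∷ # 9 ∷ # 10 ∷ # 11 ∷ # 12 ∷ # 15 ∷ [])))) (split (# 2) 0F (split (# 2) 1F (node (# 2)) (split (# 2) 3F (node (# 2)) (split (# 1) 2F (split (# 1) 0F (node (# 1)) (split (# 1) 1F (node (# 1)) (split (# 3) 0F (split (# 5) 1F (split (# 4) 1F (split (# 7) 3F (split (# 13) 1F (node (# 13)) (node (# 14))) (node (# 7))) (node (# 7))) (node (#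 6))) (node (# 6))))) (node (# 12))))) (node (# 8)))) (node (# 16))) (node (# 16)))) (node (# 11))) (node (# 9)))) (node (# 15))) (node (# 15))) (node (# 10))) (node (# 10))
refutation-c₂ = split (# 8) 1F (split (# 9) 1F (split (# 11) 2F (split (# 12) 2F (split (# 9) 3F (split (# 0) 0F (node (# 9)) (split (# 0) 1F (node (# 11)) (node (# 0)))) (split (# 0) 0F (split (# 0) 1F (split (# 0) 2F (node (# 0)) (split (# 2) 2F (split (# 13) 2F (split (# 8) 3F (split (# 2) 0F (node (# 8)) (split (# 1) 2F (node (# 12)) (cut (# 0 ∷ # 8 ∷ # 9 ∷ # 10 ∷ # 11 ∷ # 12 ∷ # 15 ∷ [])))) (split (# 2) 0F (split (# 2) 1F (node (# 2)) (split (# 2) 3F (node (# 2)) (split (# 1) 2F (split (# 3) 1F (split (# 3) 0F (node (# 3)) (split (# 1) 0F (split (# 1) 1F (node (# 1)) (split (# 1) 3F (node (# 1)) (split (# 5) 1F (split (# 4) 1F (split (# 7) 3F (split (# 13) 1F (node (# 13)) (node (# 14))) (node (# 7))) (node (# 7))) (node (# 6))))) (node (# 6)))) (node (# 14))) (node (# 12))))) (node (# 8)))) (node (# 16))) (node (# 16)))) (node (# 11))) (node (# 9)))) (node (# 15))) (node (# 15))) (node (# 10))) (node (# 10))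
refutation-c₃ = split (# 8) 1F (split (# 9) 1F (split (# 11) 2F (split (# 12) 2F (split (# 9) 3F (split (# 0) 0F (node (# 9)) (split (# 0) 1F (node (# 11)) (node (# 0)))) (split (# 0) 0F (split (# 0) 1F (split (# 0) 2F (node (# 0)) (split (# 2) 2F (split (# 2) 0F (node (# 2)) (split (# 2) 1F (node (# 2)) (split (# 8) 3F (split (# 1) 2F (node (# 12)) (cut (# 0 ∷ # 8 ∷ # 9 ∷ # 10 ∷ # 11 ∷ # 12 ∷ # 15 ∷ []))) (node (# 8))))) (node (# 16)))) (node (# 11))) (node (# 9)))) (node (# 15))) (node (# 15))) (node (# 10))) (node (# 10))

module _ {z : Node → Fin 4 → Bool} (cover : Cover z) (merged : Merged z) where
  open Soundness cover

  excluded : ∀ c b r → refutes r (assign (proj₁ (port c)) (proj₂ (port c)) b initial) ≡ true → z (proj₁ (port c)) (proj₂ (port c)) ≢ b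
  excluded c b r eq zb = sound r (assign (proj₁ (port c)) (proj₂ (port c)) b initial) (assign-consistent initial (proj₁ (port c)) (proj₂ (port c)) zb (initial-consistent merged)) eq

  opaque
    unfolding mates

    a-used : z (proj₁ (port ℓa)) (proj₂ (port ℓa)) ≢ false
    a-used = excluded ℓa false refutation-a refl

    c₁-unused : z (proj₁ (port ℓc₁)) (proj₂ (port ℓc₁)) ≢ true
    c₁-unused = excluded ℓc₁ true refutation-c₁ refl

    c₂-unused : z (proj₁ (port ℓc₂)) (proj₂ (port ℓc₂)) ≢ true
    c₂-unused = excluded ℓc₂ true refutation-c₂ refl

    c₃-unused : z (proj₁ (port ℓc₃)) (proj₂ (port ℓc₃)) ≢ true
    c₃-unused = excluded ℓc₃ true refutation-c₃ refl

-- Merging double edges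

quad-η : ∀ (f : Fin 4 → Bool) k → quad (f 0F) (f 1F) (f 2F) (f 3F) k ≡ f k
quad-η f 0F = refl
quad-η f 1F = refl
quad-η f 2F = refl
quad-η f 3F = refl

no-third : ∀ (f : Fin 4 → Bool) → count₄ f ≡ 2 → ∀ {k l h} → k ≢ l → f k ≡ true → f l ≡ true → f h ≡ true → h ≡ k ⊎ h ≡ l
no-third f two {k} {l} {h} k≢l fk fl fh = does-true (decide f) (holds (f 0F) (f 1F) (f 2F) (f 3F)) k l h two k≢l
    (trans (quad-η f k) fk) (trans (quad-η f l) fl) (trans (quad-η f h) fh)
  where
  Claim : (Fin 4 → Bool) → Set
  Claim f = let g = quad (f 0F) (f 1F) (f 2F) (f 3F) in ∀ k l h → count₄ g ≡ 2 → k ≢ l → g k ≡ true → g l ≡ true → g h ≡ true → h ≡ k ⊎ h ≡ l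
  decide : ∀ f → Dec (Claim f)
  decide f = let g = quad (f 0F) (f 1F) (f 2F) (f 3F) in all? λ k → all? λ l → all? λ h →
    (count₄ g ℕ.≟ 2) →-dec (¬? (k ≟ l) →-dec ((g k Bool.≟ true) →-dec ((g l Bool.≟ true) →-dec ((g h Bool.≟ true) →-dec (h ≟ k ⊎-dec h ≟ l)))))
  holds : ∀ a b c d → does (decide (quad a b c d)) ≡ true
  holds = ∀quad-sound (λ f → does (decide f)) refl

merge : Node → (Fin 4 → Bool) → Fin 4 → Bool
merge i f k = if duplicate i k then false else f k ∨ f (partner i k)

Exclusive : Node → (Fin 4 → Bool) → Set
Exclusive i f = ∀ k → partner i k ≢ k → ¬ (f k ≡ true × f (partner i k) ≡ true)

opaque
  unfolding mates

  -- Merging replaces the two values at a double edge by their disjunction and `false`, which keeps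
  -- the count unless both are true.
  count₄-merge : ∀ i f → Exclusive i f → count₄ f ≡ 2 → count₄ (merge i f) ≡ 2
  count₄-merge i f excl two = trans (count₄-cong λ k → sym (merge-cong k))
      (does-true (decide i g) (∀quad-sound (λ f → does (decide i f)) (holds i) (f 0F) (f 1F) (f 2F) (f 3F)) excl′ two)
    where
    g : Fin 4 → Bool
    g = quad (f 0F) (f 1F) (f 2F) (f 3F)
    merge-cong : ∀ k → merge i g k ≡ merge i f k
    merge-cong k = cong₂ (λ a b → if duplicate i k then false else a ∨ b) (quad-η f k) (quad-η f (partner i k))
    excl′ : Exclusive i g
    excl′ k p≢k (a , b) = excl k p≢k (trans (sym (quad-η f k)) a , trans (sym (quad-η f (partner i k))) b)
    decide : ∀ i f → Dec (Exclusive i f → count₄ f ≡ 2 → count₄ (merge i f) ≡ 2)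
    decide i f = (all? λ k → ¬? (partner i k ≟ k) →-dec ¬? ((f k Bool.≟ true) ×-dec (f (partner i k) Bool.≟ true))) →-dec
              ((count₄ f ℕ.≟ 2) →-dec (count₄ (merge i f) ℕ.≟ 2))
    holds : ∀ i → ∀quad (λ f → does (decide i f)) ≡ true
    holds = does-true (all? λ i → ∀quad (λ f → does (decide i f)) Bool.≟ true) refl

Parallel : Node → Fin 4 → Target → Set
Parallel i k (link c)    = partner i k ≡ k
Parallel i k (inner j l) = mate i (partner i k) ≡ inner j (partner j l) × duplicate i k ≡ duplicate j l

parallel? : ∀ i k t → Dec (Parallel i k t)
parallel? i k (link c)    = partner i k ≟ k
parallel? i k (inner j l) = (mate i (partner i k) ≟T inner j (partner j l)) ×-dec (duplicate i k Bool.≟ duplicate j l)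

opaque
  unfolding mates

  parallel : ∀ i k → Parallel i k (mate i k)
  parallel = decide₂ _ (λ i k → parallel? i k (mate i k)) refl

  partner-involutive : ∀ i k → partner i (partner i k) ≡ k
  partner-involutive = decide₂ _ (λ i k → partner i (partner i k) ≟ k) refl

  duplicate-partner : ∀ i k → duplicate i k ≡ true → duplicate i (partner i k) ≡ false
  duplicate-partner = decide₂ _ (λ i k → (duplicate i k Bool.≟ true) →-dec (duplicate i (partner i k) Bool.≟ false)) refl

module _ {x : Node → Fin 4 → Bool} (cover : Cover x) where
  open Cover cover

  -- If both edges between `i` and `j` were used, each of these nodes would already have degree two,
  -- and no used edge would leave the set of `i` and `j`, contrary to `crossing`.
  exclusive : ∀ i → Exclusive i (x i)
  exclusive i k p≢k (xk , xp) = from-mate (mate i k) refl (mate-matched i k) (parallel i k)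
    where
    from-mate : ∀ t → mate i k ≡ t → Matched i k t → Parallel i k t → ⊥
    from-mate (link c)    eq _              p≡k       = p≢k p≡k
    from-mate (inner j l) eq (back , _) (par , _) = impossible (crossing X i (X-member (inj₁ refl)))
      where
      X : Node → Bool
      X m = does (m ≟ i) ∨ does (m ≟ j)
      X-member : ∀ {m} → m ≡ i ⊎ m ≡ j → X m ≡ true
      X-member {m} (inj₁ hit) rewrite dec-true (m ≟ i) hit = refl
      X-member {m} (inj₂ hit) rewrite dec-true (m ≟ j) hit = Bool.∨-zeroʳ (does (m ≟ i))
      stays : ∀ {m h m′ h′} → mate m h ≡ inner m′ h′ → m′ ≡ i ⊎ m′ ≡ j → leaves X (mate m h) ≢ true
      stays eq hit lv = contradiction (trans (sym lv) (trans (cong (leaves X) eq) (cong not (X-member hit)))) λ ()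
      back′ : mate j (partner j l) ≡ inner i (partner i k)
      back′ = matched-inner par (mate-matched i (partner i k))
        where
        matched-inner : ∀ {t} → t ≡ inner j (partner j l) → Matched i (partner i k) t → mate j (partner j l) ≡ inner i (partner i k)
        matched-inner refl (eq , _) = eq
      l≢p : l ≢ partner j l
      l≢p hit with trans (sym back) (trans (cong (mate j) hit) back′)
      ... | refl′ = p≢k (sym (cong proj₂ (inner-injective refl′)))
        where
        inner-injective : ∀ {p q : Node × Fin 4} → inj₂ {A = Link} p ≡ inj₂ q → p ≡ q
        inner-injective refl = refl
      impossible : ¬ ∃₂ λ m h → X m ≡ true × leaves X (mate m h) ≡ true × x m h ≡ true
      impossible (m , h , Xm , lv , xmh) with ∨-true (does (m ≟ i)) Xm
      ... | inj₁ hit with refl ← does-true (m ≟ i) hit with no-third (x i) (degree-two i) (≢-sym p≢k) xk xp xmh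
      ...   | inj₁ refl = stays eq (inj₂ refl) lv
      ...   | inj₂ refl = stays par (inj₂ refl) lv
      impossible (m , h , Xm , lv , xmh) | inj₂ hit with refl ← does-true (m ≟ j) hit
          with no-third (x j) (degree-two j) l≢p (trans (sym (matched eq)) xk) (trans (sym (matched par)) xp) xmh
      ...   | inj₁ refl = stays back (inj₁ refl) lv
      ...   | inj₂ refl = stays back′ (inj₁ refl) lv

  z : Node → Fin 4 → Bool
  z i = merge i (x i)

  merged : Merged z
  merged i k dup rewrite dup = refl

  x⇒z : ∀ i k → x i k ≡ true → duplicate i k ≡ false → z i k ≡ true
  x⇒z i k xk dup rewrite dup | xk = refl

  merge-cover : Cover z
  merge-cover .Cover.degree-two i = count₄-merge i (x i) (exclusive i) (degree-two i)
  merge-cover .Cover.matched {i} {k} {j} {l} eq with subst (Parallel i k) eq (parallel i k)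
  ... | par , dup = cong₂ (λ d b → if d then false else b) dup (cong₂ _∨_ (matched eq) (matched par))
  merge-cover .Cover.crossing X i Xi with crossing X i Xi
  ... | j , k , Xj , lv , xjk with duplicate j k in dup
  ...   | false = j , k , Xj , lv , x⇒z j k xjk dup
  -- The crossing edge has been moved to its parallel edge, which leads to the same node and hence
  -- leaves `X` too.
  ...   | true  = j , partner j k , Xj , trans (sym (leaves-partner (mate j k) refl (parallel j k))) lv ,
                  subst (λ d → (if d then false else x j (partner j k) ∨ x j (partner j (partner j k))) ≡ true) (sym (duplicate-partner j k dup))
                    (trans (cong (λ h → x j (partner j k) ∨ x j h) (partner-involutive j k)) (trans (cong (x j (partner j k) ∨_) xjk) (Bool.∨-zeroʳ _)))
    where
    leaves-partner : ∀ t → mate j k ≡ t → Parallel j k t → leaves X (mate j k) ≡ leaves X (mate j (partner j k))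
    leaves-partner (link c)     eq p≡k       = cong (leaves X ∘ mate j) (sym p≡k)
    leaves-partner (inner m l)  eq (par , _) = trans (cong (leaves X) eq) (sym (cong (leaves X) par))

  opaque
    unfolding mates

    -- The port of a link is its own partner, so merging yields `b ∨ b`.
    port-used : ∀ c → z (proj₁ (port c)) (proj₂ (port c)) ≡ x (proj₁ (port c)) (proj₂ (port c))
    port-used ℓa  = Bool.∨-idem _
    port-used ℓq  = Bool.∨-idem _
    port-used ℓc₁ = Bool.∨-idem _
    port-used ℓc₂ = Bool.∨-idem _
    port-used ℓc₃ = Bool.∨-idem _
    port-used ℓr  = Bool.∨-idem _

  x-a : x (proj₁ (port ℓa)) (proj₂ (port ℓa)) ≡ true
  x-a = trans (sym (port-used ℓa)) (Bool.¬-not (a-used merge-cover merged))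

  x-c₁ : x (proj₁ (port ℓc₁)) (proj₂ (port ℓc₁)) ≡ false
  x-c₁ = trans (sym (port-used ℓc₁)) (Bool.¬-not (c₁-unused merge-cover merged))

  x-c₂ : x (proj₁ (port ℓc₂)) (proj₂ (port ℓc₂)) ≡ false
  x-c₂ = trans (sym (port-used ℓc₂)) (Bool.¬-not (c₂-unused merge-cover merged))

  x-c₃ : x (proj₁ (port ℓc₃)) (proj₂ (port ℓc₃)) ≡ false
  x-c₃ = trans (sym (port-used ℓc₃)) (Bool.¬-not (c₃-unused merge-cover merged))

-- The cover induced by a Hamiltonian cycle

module Forced (T′ : ℕ) (C : HamCycle (Ported.graph (Family.ported T′))) where
  open Family T′
  open Used ported C

  x : Node → Fin 4 → Bool
  x i k = used (δ (A i k)) 3F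

  -- Σ r = 4 * 2 - 3 * 2: a cycle uses two of the four edges leaving a K₄,₃.
  rows-and-columns : (u : Fin 4 → Fin 3 → ℕ) (r : Fin 4 → ℕ) →
    (∀ k → u k 0F + (u k 1F + (u k 2F + r k)) ≡ 2) → (∀ b → u 0F b + (u 1F b + (u 2F b + u 3F b)) ≡ 2) →
    r 0F + (r 1F + (r 2F + r 3F)) ≡ 2
  rows-and-columns u r rows cols = +-cancelˡ-≡ 6 _ _ (trans
    (cong (_+ (r 0F + (r 1F + (r 2F + r 3F)))) (sym (cong₂ _+_ (cols 0F) (cong₂ _+_ (cols 1F) (cols 2F)))))
    (trans (regroup (u 0F 0F) (u 0F 1F) (u 0F 2F) (r 0F) (u 1F 0F) (u 1F 1F) (u 1F 2F) (r 1F) (u 2F 0F) (u 2F 1F) (u 2F 2F) (r 2F) (u 3F 0F) (u 3F 1F) (u 3F 2F) (r 3F))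
      (cong₂ _+_ (rows 0F) (cong₂ _+_ (rows 1F) (cong₂ _+_ (rows 2F) (rows 3F))))))
    where
    open +-*-Solver
    regroup : ∀ a₀ a₁ a₂ a₃ b₀ b₁ b₂ b₃ c₀ c₁ c₂ c₃ d₀ d₁ d₂ d₃ →
      (a₀ + (b₀ + (c₀ + d₀)) + (a₁ + (b₁ + (c₁ + d₁)) + (a₂ + (b₂ + (c₂ + d₂))))) + (a₃ + (b₃ + (c₃ + d₃))) ≡
      (a₀ + (a₁ + (a₂ + a₃))) + ((b₀ + (b₁ + (b₂ + b₃))) + ((c₀ + (c₁ + (c₂ + c₃))) + (d₀ + (d₁ + (d₂ + d₃)))))
    regroup = solve 16 (λ a₀ a₁ a₂ a₃ b₀ b₁ b₂ b₃ c₀ c₁ c₂ c₃ d₀ d₁ d₂ d₃ →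
      (a₀ :+ (b₀ :+ (c₀ :+ d₀)) :+ (a₁ :+ (b₁ :+ (c₁ :+ d₁)) :+ (a₂ :+ (b₂ :+ (c₂ :+ d₂))))) :+ (a₃ :+ (b₃ :+ (c₃ :+ d₃))) :=
      (a₀ :+ (a₁ :+ (a₂ :+ a₃))) :+ ((b₀ :+ (b₁ :+ (b₂ :+ b₃))) :+ ((c₀ :+ (c₁ :+ (c₂ :+ c₃))) :+ (d₀ :+ (d₁ :+ (d₂ :+ d₃)))))) refl

  used-AB : ∀ i k b → used (δ (B i b)) k ≡ used (δ (A i k)) (inject₁ b)
  used-AB i k b = used-back (δ (B i b)) k

  cover : Cover x
  cover .Cover.degree-two i = rows-and-columns (λ k b → bit (used (δ (A i k)) (inject₁ b))) (λ k → bit (x i k))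
    (λ k → used-two (δ (A i k)))
    (λ b → trans (sym (count₄-cong λ k → used-AB i k b)) (used-two (δ (B i b))))
  cover .Cover.matched {i} {k} eq = trans (used-back (δ (A i k)) 3F) (cong₂ (λ v l → used v l) (cong target eq) (cong backT eq))
  -- The cycle also visits `y`, hence leaves the copies of K₄,₃ over `X`; the edges inside a copy do
  -- not lead out, so it does so at a port.
  cover .Cover.crossing X i Xi = exit (used-cut Q (δ (A i 0F)) (δ y) Xi refl)
    where
    Q : V → Bool
    Q (δ (A j _)) = X j
    Q (δ (B j _)) = X j
    Q _           = false
    leaving : ∀ t → Q (target t) ≡ false → leaves X t ≡ true
    leaving (link c)    _  = refl
    leaving (inner j l) eq = cong not eq
    exit : (∃₂ λ v k → Q v ≡ true × Q (nb v k) ≡ false × used v k ≡ true) → ∃₂ λ j k → X j ≡ true × leaves X (mate j k) ≡ true × x j k ≡ true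
    exit (δ (A j a) , 0F , Qv , Qn , u) = contradiction (trans (sym Qv) Qn) λ ()
    exit (δ (A j a) , 1F , Qv , Qn , u) = contradiction (trans (sym Qv) Qn) λ ()
    exit (δ (A j a) , 2F , Qv , Qn , u) = contradiction (trans (sym Qv) Qn) λ ()
    exit (δ (A j a) , 3F , Qv , Qn , u) = j , a , Qv , leaving (mate j a) Qn , u
    exit (δ (B j b) , k  , Qv , Qn , u) = contradiction (trans (sym Qv) Qn) λ ()

-- Forced edges

first-two : ∀ (f : Fin 4 → Bool) → count₄ f ≡ 2 → f 0F ≡ true → f 1F ≡ true → f 2F ≡ false × f 3F ≡ false
first-two f two f₀ f₁ with f 0F | f 1F | f 2F | f 3F
... | true | true | false | false = refl , refl

not-last-two : ∀ (f : Fin 4 → Bool) → count₄ f ≡ 2 → f 2F ≡ false → f 3F ≡ false → f 0F ≡ true × f 1F ≡ true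
not-last-two f two f₂ f₃ with f 0F | f 1F | f 2F | f 3F
... | true | true | false | false = refl , refl
not-last-two f () f₂ f₃ | true  | false | false | false
not-last-two f () f₂ f₃ | false | true  | false | false
not-last-two f () f₂ f₃ | false | false | false | false

module StripForced (T′ : ℕ) (C : HamCycle (Ported.graph (Family.ported T′))) where
  open Family T′
  open Forced T′ C
  open Used ported C

  used-E : ∀ {t} → t < T → ∀ k → used (E t) k ≡ used (nbE k t) (backE k t)
  used-E {t} t<T k = trans (used-back (E t) k) (cong₂ used (nb-E t<T k) (cong (backE k) (toℕ-at t<T)))

  used-O : ∀ {t} → t < T → ∀ k → used (O t) k ≡ used (nbO k t) (backO k t)
  used-O {t} t<T k = trans (used-back (O t) k) (cong₂ used (nb-O t<T k) (cong (backO k) (toℕ-at t<T)))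

  -- The recursion descends towards the core: the edges `2F` and `3F` of `O t` are those that
  -- `e-full` excludes at `E (t - 1)` and `E (t - 2)`. It stops at the four facts about `ℓa`, `ℓc₁`,
  -- `ℓc₂` and `ℓc₃`.
  e-in   : ∀ t → t < T → used (E t) 0F ≡ true
  e-mid  : ∀ t → t < T → used (E t) 1F ≡ true
  e-full : ∀ t → t < T → used (E t) 2F ≡ false × used (E t) 3F ≡ false
  o-full : ∀ t → t < T → used (O t) 0F ≡ true × used (O t) 1F ≡ true
  o-2    : ∀ t → t < T → used (O t) 2F ≡ false
  o-3    : ∀ t → t < T → used (O t) 3F ≡ false
  e-in zero    t<T = trans (used-E t<T 0F) (x-a cover)
  e-in (suc t) t<T = trans (used-E t<T 0F) (proj₁ (o-full t (<⇒≤ t<T)))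
  e-mid t t<T = trans (used-E t<T 1F) (proj₂ (o-full t t<T))
  e-full t t<T = first-two (used (E t)) (used-two (E t)) (e-in t t<T) (e-mid t t<T)
  o-full t t<T = not-last-two (used (O t)) (used-two (O t)) (o-2 t t<T) (o-3 t t<T)
  o-2 zero    t<T = trans (used-O t<T 2F) (x-c₁ cover)
  o-2 (suc t) t<T = trans (used-O t<T 2F) (proj₁ (e-full t (<⇒≤ t<T)))
  o-3 zero          t<T = trans (used-O t<T 3F) (x-c₂ cover)
  o-3 (suc zero)    t<T = trans (used-O t<T 3F) (x-c₃ cover)
  o-3 (suc (suc t)) t<T = trans (used-O t<T 3F) (proj₂ (e-full t (<⇒≤ (<⇒≤ t<T))))

-- Normal form of a Hamiltonian cycle

module Indices (T′ : ℕ) where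
  open Family T′

  -- The first T * 2 vertices are those of the strip, in the order in which
  -- every Hamiltonian cycle traverses them; y follows.
  index : ℕ → Fin (T * 2 + coresize)
  index j = next^ j zero

  index-toℕ : ∀ {i : Fin (T * 2 + coresize)} {j} → toℕ i ≡ j → i ≡ index j
  index-toℕ {i} refl = sym (next^-toℕ i)

  index-E : ∀ {t} → t < T → enc (E t) ≡ index (t * 2)
  index-E {t} t<T = index-toℕ {enc (E t)} (trans (toℕ-↑ˡ (combine {T} (at t) (zero {1})) coresize) (trans (toℕ-combine {T} (at t) (zero {1}))
    (trans (+-identityʳ _) (trans (cong (2 *_) (toℕ-at t<T)) (ℕ.*-comm 2 t)))))

  index-O : ∀ {t} → t < T → enc (O t) ≡ index (suc (t * 2))
  index-O {t} t<T = index-toℕ {enc (O t)} (trans (toℕ-↑ˡ (combine {T} (at t) (suc (zero {0}))) coresize) (trans (toℕ-combine {T} (at t) (suc (zero {0})))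
    (trans (cong (λ s → 2 * s + 1) (toℕ-at t<T)) (trans (ℕ.+-comm (2 * t) 1) (cong suc (ℕ.*-comm 2 t))))))

  index-y : enc {T} (δ y) ≡ index (T * 2)
  index-y = index-toℕ {enc {T} (δ y)} (trans (toℕ-↑ʳ (T * 2) (encD y)) (trans (cong (λ i → T * 2 + toℕ i) encD-y) (+-identityʳ _)))

  half : ∀ j s → j < s * 2 → ∃ λ t → t < s × (j ≡ t * 2 ⊎ j ≡ suc (t * 2))
  half zero          (suc s) _ = 0 , s≤s z≤n , inj₁ refl
  half (suc zero)    (suc s) _ = 0 , s≤s z≤n , inj₂ refl
  half (suc (suc j)) (suc s) (s≤s (s≤s lt)) with half j s lt
  ... | t , t<s , inj₁ refl = suc t , s≤s t<s , inj₁ refl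
  ... | t , t<s , inj₂ refl = suc t , s≤s t<s , inj₂ refl

  next-O : ∀ {t} → t < T → enc (nb (O t) 0F) ≡ index (2 + t * 2)
  next-O {t} t<T with suc t <? T
  ... | yes lt = trans (cong enc (trans (nb-O t<T 0F) (nbO-0-< lt))) (index-E lt)
  ... | no ¬lt with refl ← last-index t<T ¬lt = trans (cong enc (trans (nb-O t<T 0F) nbO-0-last)) index-y

  -- Serves twice, with `R` the edges of a given cycle and with `R` adjacency in the graph.
  along-strip : (R : Fin (T * 2 + coresize) → Fin (T * 2 + coresize) → Set) →
                (∀ t → t < T → R (enc (E t)) (enc (nb (E t) 1F))) → (∀ t → t < T → R (enc (O t)) (enc (nb (O t) 0F))) →
                ∀ j → j < T * 2 → R (index j) (index (suc j))
  along-strip R RE RO j j< with half j T j<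
  ... | t , t<T , inj₁ refl = subst₂ R (index-E t<T) (trans (cong enc (nb-E t<T 1F)) (index-O t<T)) (RE t t<T)
  ... | t , t<T , inj₂ refl = subst₂ R (index-O t<T) (next-O t<T) (RO t t<T)

module Canonical (T′ : ℕ) where
  open Family T′
  open Indices T′
  open Ported ported using (graph)

  -- Fixes the starting point as well as the direction of a cycle.
  StripFirst : HamCycle graph → Set
  StripFirst C = ∀ j → j ≤ T * 2 → order C (index j) ≡ index j

  module _ (C : HamCycle graph) where
    open StripForced T′ C
    open Used ported C

    strip-edge : ∀ j → j < T * 2 → CycleEdge C (index j) (index (suc j))
    strip-edge = along-strip (CycleEdge C) (λ t t<T → used⇒edge {E t} {1F} (e-mid t t<T)) (λ t t<T → used⇒edge {O t} {0F} (proj₁ (o-full t t<T)))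

  stripFirst : (C : HamCycle graph) → Σ (HamCycle graph) λ C′ → SameCycle C C′ × StripFirst C′
  stripFirst C = first (startingFrom {suc (suc M)} {graph} C {index 0} {index 1} (strip-edge C 0 (s≤s z≤n)))
    where
    M : ℕ
    M = suc (T′ * 2 + coresize)
    first : (Σ (HamCycle graph) λ D → SameCycle C D × order D zero ≡ index 0 × order D (next zero) ≡ index 1) →
            Σ (HamCycle graph) λ D → SameCycle C D × StripFirst D
    -- `follow` reaches one position beyond its length argument, so `3 + T′ * 2` yields all
    -- positions up to `T * 2`.
    first (D , same , eq₀ , eq₁) = D , same , follow {M} {graph} D index (3 + T′ * 2) eq₀ eq₁
      λ i i< → strip-edge D (suc i) (s≤s i<) , next²≢ {M} (index i)

  -- The edge from `E 0` to `π ℓa` is used and the successor of `E 0` is `O 0`, so `π ℓa` is its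
  -- predecessor.
  last-a : (C : HamCycle graph) → StripFirst C → order C (prev zero) ≡ enc (π ℓa)
  last-a C first = use edge
    where
    open StripForced T′ C
    open Used ported C
    edge : CycleEdge C zero (enc (π ℓa))
    edge = subst₂ (CycleEdge C) (index-E (s≤s z≤n)) (cong enc (nb-E (s≤s z≤n) 0F)) (used⇒edge {E 0} {0F} (e-in 0 (s≤s z≤n)))
    use : CycleEdge C zero (enc (π ℓa)) → order C (prev zero) ≡ enc (π ℓa)
    use (i , inj₁ (p , q)) = contradiction (Ported.enc-inj ported {O 0} {π ℓa} (trans (index-O (s≤s z≤n)) (trans (sym (first 1 (s≤s z≤n)))
      (trans (cong (order C ∘ next) (injective C (trans (first 0 z≤n) (sym p)))) q)))) λ ()
    use (i , inj₂ (p , q)) = trans (cong (order C) (trans (cong prev (injective C (trans (first 0 z≤n) (sym q)))) (prev-next i))) p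

-- Enumerating a decidable set of functions

enumerate : ∀ {K} {P : Fin K → Set} → (∀ k → Dec (P k)) →
            ∃ λ c → Σ (Fin c → Fin K) λ g → Injective _≡_ _≡_ g × (∀ i → P (g i)) × (∀ k → P k → ∃ λ i → g i ≡ k)
enumerate {zero}  P? = 0 , (λ ()) , (λ { {()} }) , (λ ()) , λ ()
enumerate {suc K} P? with enumerate (P? ∘ suc) | P? zero
... | c , g , inj , Pg , onto | no ¬p = c , suc ∘ g , (λ eq → inj (Data.Fin.Properties.suc-injective eq)) , Pg ,
      λ { zero p → contradiction p ¬p ; (suc k) p → let i , eq = onto k p in i , cong suc eq }
... | c , g , inj , Pg , onto | yes p = suc c , g′ , inj′ , Pg′ , onto′
  where
  g′ : Fin (suc c) → Fin (suc K)
  g′ zero    = zero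
  g′ (suc i) = suc (g i)
  inj′ : Injective _≡_ _≡_ g′
  inj′ {zero}  {zero}  _  = refl
  inj′ {suc i} {suc j} eq = cong suc (inj (Data.Fin.Properties.suc-injective eq))
  Pg′ : ∀ i → _
  Pg′ zero    = p
  Pg′ (suc i) = Pg i
  onto′ : ∀ k → _ → ∃ λ i → g′ i ≡ k
  onto′ zero    _ = zero , refl
  onto′ (suc k) q = let i , eq = onto k q in suc i , cong suc eq

funToFin-cong : ∀ {m n} {f g : Fin m → Fin n} → f ≗ g → funToFin f ≡ funToFin g
funToFin-cong {zero}  eq = refl
funToFin-cong {suc m} eq = cong₂ combine (eq zero) (funToFin-cong (eq ∘ suc))

-- Functions are coded by the elements of `Fin (m ^ m)`. Decoding recovers a function only
-- pointwise, so `P` has to respect `≗`.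
enumerateFunctions : ∀ {m} {P : (Fin m → Fin m) → Set} → (∀ f → Dec (P f)) → (∀ {f g} → f ≗ g → P f → P g) →
                     ∃ λ c → Σ (Fin c → Fin m → Fin m) λ g → (∀ {i j} → g i ≗ g j → i ≡ j) × (∀ i → P (g i)) × (∀ f → P f → ∃ λ i → g i ≗ f)
enumerateFunctions {m} {P} P? resp with enumerate {m ^ m} {P ∘ finToFun} (λ k → P? (finToFun k))
... | c , g , inj , Pg , onto = c , finToFun ∘ g ,
      (λ {i} {j} eq → inj (trans (sym (funToFin-finToFin {m} (g i))) (trans (funToFin-cong eq) (funToFin-finToFin {m} (g j))))) , Pg ,
      λ f p → let i , eq = onto (funToFin f) (resp (sym ∘ finToFun-funToFin f) p) in
        i , λ x → trans (cong (λ k → finToFun k x) eq) (finToFun-funToFin f x)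

-- Extending a permutation of the last positions by the identity

module _ {L m : ℕ} where

  extend : (Fin m → Fin m) → Fin (L + m) → Fin (L + m)
  extend f i = [ _↑ˡ m , (L ↑ʳ_) ∘ f ]′ (splitAt L i)

  extend-↑ˡ : ∀ f k → extend f (k ↑ˡ m) ≡ k ↑ˡ m
  extend-↑ˡ f k rewrite splitAt-↑ˡ L k m = refl

  extend-↑ʳ : ∀ f k → extend f (L ↑ʳ k) ≡ L ↑ʳ f k
  extend-↑ʳ f k rewrite splitAt-↑ʳ L m k = refl

  side : (i : Fin (L + m)) → (∃ λ k → k ↑ˡ m ≡ i) ⊎ (∃ λ k → L ↑ʳ k ≡ i)
  side i with splitAt L i in eq
  ... | inj₁ k = inj₁ (k , splitAt⁻¹-↑ˡ eq)
  ... | inj₂ k = inj₂ (k , splitAt⁻¹-↑ʳ eq)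

  ↑ˡ≢↑ʳ : ∀ {k l} → k ↑ˡ m ≢ L ↑ʳ l
  ↑ˡ≢↑ʳ {k} {l} eq = ℕ.<⇒≱ (toℕ<n k) (ℕ.≤-trans (ℕ.m≤m+n L (toℕ l)) (ℕ.≤-reflexive (trans (sym (toℕ-↑ʳ L l)) (trans (cong toℕ (sym eq)) (toℕ-↑ˡ k m)))))

  extend-injective : ∀ {f} → Injective _≡_ _≡_ f → Injective _≡_ _≡_ (extend f)
  extend-injective {f} inj {i} {j} eq with side i | side j
  ... | inj₁ (k , refl) | inj₁ (l , refl) = trans (sym (extend-↑ˡ f k)) (trans eq (extend-↑ˡ f l))
  ... | inj₁ (k , refl) | inj₂ (l , refl) = contradiction (trans (sym (extend-↑ˡ f k)) (trans eq (extend-↑ʳ f l))) ↑ˡ≢↑ʳ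
  ... | inj₂ (k , refl) | inj₁ (l , refl) = contradiction (trans (sym (extend-↑ˡ f l)) (trans (sym eq) (extend-↑ʳ f k))) ↑ˡ≢↑ʳ
  ... | inj₂ (k , refl) | inj₂ (l , refl) = cong (L ↑ʳ_) (inj (↑ʳ-injective L _ _ (trans (sym (extend-↑ʳ f k)) (trans eq (extend-↑ʳ f l)))))

module _ {L m : ℕ} where

  toℕ-next^ : ∀ j → j < suc L + suc m → toℕ (next^ j (zero {L + suc m})) ≡ j
  toℕ-next^ zero    _  = refl
  toℕ-next^ (suc j) lt = trans (toℕ-next (subst (_< suc L + suc m) (cong suc (sym IH)) lt)) (cong suc IH)
    where
    IH : toℕ (next^ j (zero {L + suc m})) ≡ j
    IH = toℕ-next^ j (<⇒≤ lt)

  ↑ʳ-zero : suc L ↑ʳ zero {m} ≡ next^ (suc L) zero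
  ↑ʳ-zero = toℕ-injective (trans (toℕ-↑ʳ (suc L) (zero {m})) (trans (+-identityʳ (suc L)) (sym (toℕ-next^ (suc L) (s≤s (ℕ.≤-trans (n<1+n L) (ℕ.≤-trans (s≤s (ℕ.m≤m+n L m)) (ℕ.≤-reflexive (sym (ℕ.+-suc L m))))))))))

  ↑ˡ-next^ : ∀ (k : Fin (suc L)) → k ↑ˡ suc m ≡ next^ (toℕ k) zero
  ↑ˡ-next^ k = trans (sym (next^-toℕ (k ↑ˡ suc m))) (cong (λ j → next^ j zero) (toℕ-↑ˡ k (suc m)))

  next-↑ʳ : ∀ (k : Fin m) → next (suc L ↑ʳ inject₁ k) ≡ suc L ↑ʳ suc k
  next-↑ʳ k = toℕ-injective (trans (toℕ-next (subst (_< suc L + suc m) (sym eq) (ℕ.+-monoʳ-< (suc L) (s≤s (toℕ<n k))))) (trans eq (sym (toℕ-↑ʳ (suc L) (suc k)))))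
    where
    eq : suc (toℕ (suc L ↑ʳ inject₁ k)) ≡ suc L + suc (toℕ k)
    eq = trans (cong suc (trans (toℕ-↑ʳ (suc L) (inject₁ k)) (cong (suc L +_) (toℕ-inject₁ k)))) (sym (ℕ.+-suc (suc L) (toℕ k)))

  next-↑ʳ-last : next (suc L ↑ʳ fromℕ m) ≡ zero
  next-↑ʳ-last = next-last (trans (toℕ-↑ʳ (suc L) (fromℕ m)) (trans (cong (suc L +_) (toℕ-fromℕ m)) (sym (ℕ.+-suc L m))))

-- Hamiltonian paths of the core

_≟D_ : (d d′ : D) → Dec (d ≡ d′)
y     ≟D y     = yes refl
A i a ≟D A j b = map′ (λ { (refl , refl) → refl }) (λ { refl → refl , refl }) (i ≟ j ×-dec a ≟ b)
B i a ≟D B j b = map′ (λ { (refl , refl) → refl }) (λ { refl → refl , refl }) (i ≟ j ×-dec a ≟ b)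
y     ≟D A _ _ = no λ ()
y     ≟D B _ _ = no λ ()
A _ _ ≟D y     = no λ ()
A _ _ ≟D B _ _ = no λ ()
B _ _ ≟D y     = no λ ()
B _ _ ≟D A _ _ = no λ ()

coreTarget : Target → Maybe D
coreTarget (link ℓq)   = just y
coreTarget (link _)    = nothing
coreTarget (inner j l) = just (A j l)

-- Edges into the strip become `nothing`. The result is independent of `T′`, and so is the number of
-- Hamiltonian paths.
coreNb : D → Fin 4 → Maybe D
coreNb y       0F = just (A (proj₁ (port ℓq)) (proj₂ (port ℓq)))
coreNb y       _  = nothing
coreNb (A i a) 0F = just (B i 0F)
coreNb (A i a) 1F = just (B i 1F)
coreNb (A i a) 2F = just (B i 2F)
coreNb (A i a) 3F = coreTarget (mate i a)
coreNb (B i b) k  = just (A i k)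

module _ (T′ : ℕ) where
  open Family T′

  coreTarget-sound : ∀ t {d} → coreTarget t ≡ just d → target t ≡ δ d
  coreTarget-sound (link ℓq)   refl = refl
  coreTarget-sound (inner j l) refl = refl

  coreTarget-complete : ∀ t {d} → target t ≡ δ d → coreTarget t ≡ just d
  coreTarget-complete (link ℓq)   refl = refl
  coreTarget-complete (link ℓc₁)  ()
  coreTarget-complete (link ℓc₂)  ()
  coreTarget-complete (link ℓc₃)  ()
  coreTarget-complete (link ℓr)  ()
  coreTarget-complete (inner j l) refl = refl

  coreNb-sound : ∀ d k {d′} → coreNb d k ≡ just d′ → nb (δ d) k ≡ δ d′
  coreNb-sound y       0F refl = refl
  coreNb-sound (A i a) 0F refl = refl
  coreNb-sound (A i a) 1F refl = refl
  coreNb-sound (A i a) 2F refl = refl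
  coreNb-sound (A i a) 3F eq   = coreTarget-sound (mate i a) eq
  coreNb-sound (B i b) k  refl = refl

  coreNb-complete : ∀ d k {d′} → nb (δ d) k ≡ δ d′ → coreNb d k ≡ just d′
  coreNb-complete y       0F refl = refl
  coreNb-complete y       1F ()
  coreNb-complete y       2F ()
  coreNb-complete y       3F ()
  coreNb-complete (A i a) 0F refl = refl
  coreNb-complete (A i a) 1F refl = refl
  coreNb-complete (A i a) 2F refl = refl
  coreNb-complete (A i a) 3F eq   = coreTarget-complete (mate i a) eq
  coreNb-complete (B i b) k  refl = refl

CoreHamPath : (Fin coresize → Fin coresize) → Set
CoreHamPath f = f zero ≡ zero × f (fromℕ (17 * 7)) ≡ encD (A (proj₁ (port ℓa)) (proj₂ (port ℓa))) × (∀ i j → f i ≡ f j → i ≡ j) ×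
                (∀ i → ∃ λ k → coreNb (decD (f (inject₁ i))) k ≡ just (decD (f (suc i))))

coreHamPath? : ∀ f → Dec (CoreHamPath f)
coreHamPath? f = f zero ≟ zero ×-dec f (fromℕ (17 * 7)) ≟ encD _ ×-dec (all? λ i → all? λ j → f i ≟ f j →-dec i ≟ j) ×-dec
                 (all? λ i → any? λ k → Maybe.≡-dec _≟D_ (coreNb (decD (f (inject₁ i))) k) (just (decD (f (suc i)))))

CoreHamPath-resp : ∀ {f g} → f ≗ g → CoreHamPath f → CoreHamPath g
CoreHamPath-resp eq (start , finish , inj , steps) = trans (sym (eq _)) start , trans (sym (eq _)) finish ,
  (λ i j e → inj i j (trans (eq i) (trans e (sym (eq j))))) ,
  λ i → let k , s = steps i in k , trans (cong (λ x → coreNb (decD x) k) (sym (eq _))) (trans s (cong (just ∘ decD) (eq _)))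

abstract
  -- Its first component is the constant of the theorem. Abstract, since evaluation would run
  -- through all 120 ^ 120 functions.
  corePaths : ∃ λ c → Σ (Fin c → Fin coresize → Fin coresize) λ g →
              (∀ {i j} → g i ≗ g j → i ≡ j) × (∀ i → CoreHamPath (g i)) × (∀ f → CoreHamPath f → ∃ λ i → g i ≗ f)
  corePaths = enumerateFunctions coreHamPath? CoreHamPath-resp

-- One Hamiltonian path of the core

visit : Node → Fin 4 → Fin 4 → Fin 4 → Fin 4 → Vec D 7
visit i a b c d = A i a ∷ B i 0F ∷ A i b ∷ B i 1F ∷ A i c ∷ B i 2F ∷ A i d ∷ []

-- From `y` over `ℓq` into node 4 and finally to the port of `ℓa` at node 5. Each copy is entered at
-- the first port of its `visit` and left at the last.
corePath : Vec D coresize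
corePath = y ∷ concat (
  visit (# 4) 3F 0F 2F 1F ∷
  visit (# 7) 1F 2F 3F 0F ∷
  visit (# 1) 1F 0F 3F 2F ∷
  visit (# 12) 0F 1F 3F 2F ∷
  visit (# 15) 2F 1F 3F 0F ∷
  visit (# 11) 2F 1F 3F 0F ∷
  visit (# 0) 1F 2F 3F 0F ∷
  visit (# 9) 0F 2F 3F 1F ∷
  visit (# 10) 2F 1F 3F 0F ∷
  visit (# 8) 1F 2F 3F 0F ∷
  visit (# 2) 0F 1F 3F 2F ∷
  visit (# 16) 2F 0F 1F 3F ∷
  visit (# 13) 2F 0F 3F 1F ∷
  visit (# 14) 3F 0F 2F 1F ∷
  visit (# 3) 1F 2F 3F 0F ∷
  visit (# 6) 1F 0F 3F 2F ∷
  visit (# 5) 1F 0F 2F 3F ∷ [])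

opaque
  unfolding mates

  corePath-unique : Unique corePath
  corePath-unique = does-true (allPairs? (λ d d′ → ¬? (d ≟D d′)) corePath) refl

  corePath-steps : ∀ i → ∃ λ k → coreNb (lookup corePath (inject₁ i)) k ≡ just (lookup corePath (suc i))
  corePath-steps = does-true (all? λ i → any? λ k → Maybe.≡-dec _≟D_ (coreNb (lookup corePath (inject₁ i)) k) (just (lookup corePath (suc i)))) refl

corePath-good : CoreHamPath (encD ∘ lookup corePath)
corePath-good = encD-y , refl ,
  (λ i j eq → lookup-injective corePath-unique i j (trans (sym (decD-encD _)) (trans (cong decD eq) (decD-encD _)))) ,
  λ i → let k , s = corePath-steps i in k , trans (cong (λ d → coreNb d k) (decD-encD _)) (trans s (cong just (sym (decD-encD _))))

-- Hamiltonian cycles correspond to Hamiltonian paths of the core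

module Correspondence (T′ : ℕ) where
  open Family T′
  open Indices T′
  open Canonical T′
  open Ported ported using (graph; enc-inj; adj-nb; adj⇒nb)

  L : ℕ
  L = T * 2

  Size : ℕ
  Size = L + coresize

  Adjacent : Fin Size → Fin Size → Set
  Adjacent u v = adj graph u v ≡ true

  enc-core : ∀ x → enc {T} (δ (decD x)) ≡ L ↑ʳ x
  enc-core x = cong (L ↑ʳ_) (encD-decD x)

  strip-adjacent : ∀ j → j < L → Adjacent (index j) (index (suc j))
  strip-adjacent = along-strip Adjacent (λ t _ → adj-nb (E t) 1F) (λ t _ → adj-nb (O t) 0F)

  core-adjacent : ∀ {x z k} → coreNb (decD x) k ≡ just (decD z) → Adjacent (L ↑ʳ x) (L ↑ʳ z)
  core-adjacent {x} {z} {k} eq = subst₂ Adjacent (enc-core x)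
    (trans (cong enc (coreNb-sound T′ (decD x) k eq)) (enc-core z)) (adj-nb (δ (decD x)) k)

  adjacent-core : ∀ {x z} → Adjacent (L ↑ʳ x) (L ↑ʳ z) → ∃ λ k → coreNb (decD x) k ≡ just (decD z)
  adjacent-core {x} {z} adjacent = found (adj⇒nb (δ (decD x)) (subst (λ u → Adjacent u (L ↑ʳ z)) (sym (enc-core x)) adjacent))
    where
    found : (∃ λ k → enc (nb (δ (decD x)) k) ≡ L ↑ʳ z) → ∃ λ k → coreNb (decD x) k ≡ just (decD z)
    found (k , eq) = k , coreNb-complete T′ (decD x) k (enc-inj (trans eq (sym (enc-core z))))

  closing-adjacent : Adjacent (enc (π ℓa)) zero
  closing-adjacent = trans (Graph.sym graph (enc (π ℓa)) zero) (subst₂ Adjacent (index-E (s≤s z≤n)) (cong enc (nb-E (s≤s z≤n) 0F)) (adj-nb (E 0) 0F))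

  index-core : L ↑ʳ zero {17 * 7} ≡ index L
  index-core = ↑ʳ-zero {3 + T′ * 2} {17 * 7}

  index-strip : ∀ (k : Fin L) → k ↑ˡ coresize ≡ index (toℕ k)
  index-strip = ↑ˡ-next^ {3 + T′ * 2} {17 * 7}

  module Build (f : Fin coresize → Fin coresize) (good : CoreHamPath f) where

    ext : Fin Size → Fin Size
    ext = extend {L} f

    ext-index : ∀ j → j ≤ L → ext (index j) ≡ index j
    ext-index j j≤L with ℕ.m≤n⇒m<n∨m≡n j≤L
    ... | inj₂ refl = trans (cong ext (sym index-core)) (trans (extend-↑ʳ {L} f zero) (trans (cong (L ↑ʳ_) (proj₁ good)) index-core))
    ... | inj₁ j<L  = trans (cong ext (sym at-j)) (trans (extend-↑ˡ {L} f (Fin.fromℕ< j<L)) at-j)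
      where
      at-j : Fin.fromℕ< j<L ↑ˡ coresize ≡ index j
      at-j = trans (index-strip (Fin.fromℕ< j<L)) (cong index (Data.Fin.Properties.toℕ-fromℕ< j<L))

    ext-adjacent : ∀ i → Adjacent (ext i) (ext (next i))
    ext-adjacent i with side {L} {coresize} i
    ... | inj₁ (k , refl) = subst (λ i → Adjacent (ext i) (ext (next i))) (sym (index-strip k))
          (subst₂ Adjacent (sym (ext-index (toℕ k) (<⇒≤ (toℕ<n k)))) (sym (ext-index (suc (toℕ k)) (toℕ<n k))) (strip-adjacent (toℕ k) (toℕ<n k)))
    ... | inj₂ (k , refl) = core-step k
      where
      core-step : ∀ k → Adjacent (ext (L ↑ʳ k)) (ext (next (L ↑ʳ k)))
      core-step k with view k
      ... | ‵inject₁ l = subst₂ Adjacent (sym (extend-↑ʳ {L} f (inject₁ l))) (sym (trans (cong ext (next-↑ʳ {3 + T′ * 2} l)) (extend-↑ʳ {L} f (suc l))))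
            (core-adjacent (proj₂ (proj₂ (proj₂ (proj₂ good)) l)))
      ... | ‵fromℕ = subst₂ Adjacent (sym (trans (extend-↑ʳ {L} f (fromℕ _)) (cong (L ↑ʳ_) (proj₁ (proj₂ good)))))
            (sym (trans (cong ext (next-↑ʳ-last {3 + T′ * 2} {17 * 7})) (ext-index 0 z≤n))) closing-adjacent

    cycle : HamCycle graph
    cycle .order         = ext
    cycle .injective     = extend-injective {L} (λ {i} {j} → proj₁ (proj₂ (proj₂ good)) i j)
    cycle .adjacent      = ext-adjacent

  open Build

  -- Both cycles begin with the first two vertices of the strip, so by `agreement` equal edge sets
  -- force equal orders.
  same⇒≗ : ∀ {f g} (p : CoreHamPath f) (q : CoreHamPath g) → SameCycle (cycle f p) (cycle g q) → f ≗ g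
  same⇒≗ {f} {g} p q same i = ↑ʳ-injective L (f i) (g i) (trans (sym (extend-↑ʳ {L} f i)) (trans
    (agreement {suc (T′ * 2 + coresize)} {graph} {cycle f p} {cycle g q} same
      (trans (ext-index f p 0 z≤n) (sym (ext-index g q 0 z≤n))) (trans (ext-index f p 1 (s≤s z≤n)) (sym (ext-index g q 1 (s≤s z≤n)))) (L ↑ʳ i))
    (extend-↑ʳ {L} g i)))

  module Extract (C : HamCycle graph) (first : StripFirst C) where

    -- The strip vertices already occupy the strip positions, so by injectivity only core vertices
    -- are left for the core positions.
    core-position : ∀ i → ∃ λ k → order C (L ↑ʳ i) ≡ L ↑ʳ k
    core-position i with side {L} {coresize} (order C (L ↑ʳ i))
    ... | inj₂ (k , eq) = k , sym eq
    ... | inj₁ (k , eq) = contradiction (injective C (trans (cong (order C) (index-strip k))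
          (trans (first (toℕ k) (<⇒≤ (toℕ<n k))) (trans (sym (index-strip k)) eq)))) (↑ˡ≢↑ʳ {L})

    f : Fin coresize → Fin coresize
    f i = proj₁ (core-position i)

    order-core : ∀ i → order C (L ↑ʳ i) ≡ L ↑ʳ f i
    order-core i = proj₂ (core-position i)

    good : CoreHamPath f
    good = ↑ʳ-injective L (f zero) zero (trans (sym (order-core zero)) (trans (cong (order C) index-core) (trans (first L ≤-refl) (sym index-core)))) ,
           ↑ʳ-injective L _ _ (trans (sym (order-core (fromℕ (17 * 7)))) (trans (cong (order C)
             (trans (sym (prev-next _)) (cong prev (next-↑ʳ-last {3 + T′ * 2} {17 * 7})))) (last-a C first))) ,
           (λ i j eq → ↑ʳ-injective L i j (injective C (trans (order-core i) (trans (cong (L ↑ʳ_) eq) (sym (order-core j)))))) ,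
           λ i → adjacent-core (subst₂ Adjacent (order-core (inject₁ i)) (trans (cong (order C) (next-↑ʳ {3 + T′ * 2} i)) (order-core (suc i))) (adjacent C (L ↑ʳ inject₁ i)))

    order≗ : ∀ {g} (q : CoreHamPath g) → g ≗ f → ∀ i → order C i ≡ order (cycle g q) i
    order≗ {g} q eq i with side {L} {coresize} i
    ... | inj₁ (k , refl) = trans (cong (order C) (index-strip k)) (trans (first (toℕ k) (<⇒≤ (toℕ<n k))) (trans (sym (index-strip k)) (sym (extend-↑ˡ {L} g k))))
    ... | inj₂ (k , refl) = trans (order-core k) (trans (cong (L ↑ʳ_) (sym (eq k))) (sym (extend-↑ʳ {L} g k)))

  exactly : HasExactlyHamCycles graph (proj₁ corePaths)
  exactly = count corePaths
    where
    count : (p : ∃ λ c → Σ (Fin c → Fin coresize → Fin coresize) λ g →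
              (∀ {i j} → g i ≗ g j → i ≡ j) × (∀ i → CoreHamPath (g i)) × (∀ f → CoreHamPath f → ∃ λ i → g i ≗ f)) →
            HasExactlyHamCycles graph (proj₁ p)
    count (c , g , distinct , good , onto) = (λ i → cycle (g i) (good i)) , (λ i j same → distinct (same⇒≗ (good i) (good j) same)) , complete
      where
      complete : ∀ C → ∃ λ i → SameCycle C (cycle (g i) (good i))
      complete C = found (stripFirst C)
        where
        found : (Σ (HamCycle graph) λ D → SameCycle C D × StripFirst D) → ∃ λ i → SameCycle C (cycle (g i) (good i))
        found (D , same , first) = let i , eq = onto (Extract.f D first) (Extract.good D first) in
          i , SameCycle-trans {C = C} {D} {cycle (g i) (good i)} same (SameCycle-≗ {C = D} {cycle (g i) (good i)} (Extract.order≗ D first (good i) eq))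

corePaths-positive : 0 < proj₁ corePaths
corePaths-positive = positive (proj₁ (proj₂ (proj₂ (proj₂ (proj₂ corePaths))) (encD ∘ lookup corePath) corePath-good))
  where
  open import Data.Vec using (lookup)
  positive : ∀ {c} → Fin c → 0 < c
  positive {suc c} _ = s≤s z≤n

mainTheorem1 : Σ ℕ λ c → (0 < c) × (∀ (N : ℕ) → ∃ λ n → (N ≤ n) × Σ (Graph n) λ G → FourRegular G × FourConnected G × HasExactlyHamCycles G c)
mainTheorem1 = proj₁ corePaths , corePaths-positive , λ N →
  Family.T N * 2 + coresize ,
  ℕ.≤-trans (ℕ.m≤m*n N 2) (ℕ.≤-trans (ℕ.*-monoˡ-≤ 2 (ℕ.m≤n+m N 2)) (ℕ.m≤m+n _ coresize)) ,
  Ported.graph (Family.ported N) , Ported.regular (Family.ported N) , four-connected N , Correspondence.exactly N
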